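{- Let $g$ be a function such that for every real $c\geq 1$, every finite graph $G$ with growth $f_G(r)\leq cr$ for all positive integers $r$ has $\operatorname{tw}(G)\leq g(c)$. Then $g(c)\in\Omega(c\log c)$ (as $c\to\infty$).
   Context: $\log$ is the natural logarithm. The growth of a finite graph $G$ is the function $f_G\colon\mathbb{N}\to\mathbb{N}$ where $f_G(r)$ is the maximum of $|V(H)|$ over all subgraphs $H$ of $G$ of radius at most $r$. $\operatorname{tw}(G)$ denotes the treewidth of $G$: the minimum, over tree-decompositions $(B_x: x\in V(T))$ of $G$ (bags indexed by a tree $T$, each edge in some bag, each vertex's bags forming a non-empty subtree), of the maximum bag size minus $1$. -}

module Defs where

open import Data.Bool.Base using (Bool; T; false)
open import Data.Fin.Base using (Fin)
open import Data.Fin.Subset using (Subset; _∈_; ∣_∣)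
open import Data.Integer.Base as ℤ using (ℤ; +_; 1ℤ)
import Data.Integer.Properties as ℤ
open import Data.List.Base using (List; []; _∷_; _∷ʳ_; length)
open import Data.List.Relation.Unary.Linked using (Linked)
open import Data.List.Relation.Unary.Unique.Propositional using (Unique)
open import Data.Nat.Base as ℕ using (ℕ; zero; suc)
import Data.Nat.Properties as ℕ
open import Data.Product.Base using (∃; ∃-syntax; Σ-syntax; _×_; _,_; proj₁; proj₂)
open import Data.Rational.Base as ℚ using
  (ℚ; mkℚ; 0ℚ; 1ℚ; ½; _+_; _*_; _-_; -_; 1/_; _⊔_; _⊓_; _≤_; _<_; toℚᵘ)
import Data.Rational.Properties as ℚ
import Data.Rational.Unnormalised.Base as ℚᵘ
import Data.Rational.Unnormalised.Properties as ℚᵘ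
open import Data.Rational.Solver using (module +-*-Solver)
open import Data.Sum.Base using (inj₁; inj₂)
import Data.Vec.Functional as Vector
open import Level using (0ℓ)
open import Relation.Binary.Core using (Rel)
open import Relation.Binary.Construct.Closure.ReflexiveTransitive using (Star)
open import Relation.Binary.PropositionalEquality
open import Relation.Nullary.Negation using (¬_)

abs : ℚ → ℚ
abs = ℚ.∣_∣

mulˡ-≤ : ∀ {p q r} → 0ℚ ≤ r → p ≤ q → r * p ≤ r * q
mulˡ-≤ {r = r} 0≤r = ℚ.*-monoˡ-≤-nonNeg r ⦃ ℚ.nonNegative 0≤r ⦄

mulʳ-≤ : ∀ {p q r} → 0ℚ ≤ r → p ≤ q → p * r ≤ q * r
mulʳ-≤ {r = r} 0≤r = ℚ.*-monoʳ-≤-nonNeg r ⦃ ℚ.nonNegative 0≤r ⦄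

mul-nonNeg : ∀ {p q} → 0ℚ ≤ p → 0ℚ ≤ q → 0ℚ ≤ p * q
mul-nonNeg {p} {q} 0≤p 0≤q = subst (_≤ p * q) (ℚ.*-zeroʳ p) (mulˡ-≤ 0≤p 0≤q)

add-nonNeg : ∀ {p q} → 0ℚ ≤ p → 0ℚ ≤ q → 0ℚ ≤ p + q
add-nonNeg = ℚ.+-mono-≤

mul-pos : ∀ {p q} → 0ℚ < p → 0ℚ < q → 0ℚ < p * q
mul-pos {p} {q} 0<p 0<q =
  subst (_< p * q) (ℚ.*-zeroʳ p) (ℚ.*-monoʳ-<-pos p ⦃ ℚ.positive 0<p ⦄ 0<q)

0<½ : 0ℚ < ½
0<½ = ℚ.positive⁻¹ ½

0≤½ : 0ℚ ≤ ½
0≤½ = ℚ.<⇒≤ 0<½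

half-pos : ∀ {ε} → 0ℚ < ε → 0ℚ < ½ * ε
half-pos = mul-pos 0<½

halves : ∀ ε → ½ * ε + ½ * ε ≡ ε
halves = solve 1 (λ ε → con ½ :* ε :+ con ½ :* ε := ε) refl
  where open +-*-Solver

abs-≤ : ∀ {p e} → p ≤ e → - p ≤ e → abs p ≤ e
abs-≤ {p} p≤e -p≤e with ℚ.∣p∣≡p∨∣p∣≡-p p
... | inj₁ eq = subst (_≤ _) (sym eq) p≤e
... | inj₂ eq = subst (_≤ _) (sym eq) -p≤e

p≤abs : ∀ p → p ≤ abs p
p≤abs p with ℚ.∣p∣≡p∨∣p∣≡-p p
... | inj₁ eq = ℚ.≤-reflexive (sym eq)
... | inj₂ eq = ℚ.≤-trans
  (subst₂ _≤_ (solve 1 (λ p → :- (:- p) := p) refl p) refl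
    (ℚ.neg-antimono-≤ (subst (0ℚ ≤_) eq (ℚ.0≤∣p∣ p))))
  (ℚ.0≤∣p∣ p)
  where open +-*-Solver

abs-sym : ∀ p q → abs (p - q) ≡ abs (q - p)
abs-sym p q = trans (sym (ℚ.∣-p∣≡∣p∣ (p - q)))
  (cong abs (solve 2 (λ p q → :- (p :- q) := q :- p) refl p q))
  where open +-*-Solver

abs-+ : ∀ {p q r a b} → p ≡ q + r → abs q ≤ a → abs r ≤ b → abs p ≤ a + b
abs-+ {q = q} {r} refl q≤a r≤b = ℚ.≤-trans (ℚ.∣p+q∣≤∣p∣+∣q∣ q r) (ℚ.+-mono-≤ q≤a r≤b)

abs-* : ∀ {p q a b} → abs p ≤ a → abs q ≤ b → abs (p * q) ≤ a * b
abs-* {p} {q} {a} {b} p≤a q≤b = subst (_≤ a * b) (sym (ℚ.∣p*q∣≡∣p∣*∣q∣ p q))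
  (ℚ.≤-trans (mulʳ-≤ (ℚ.0≤∣p∣ q) p≤a) (mulˡ-≤ (ℚ.≤-trans (ℚ.0≤∣p∣ p) p≤a) q≤b))

abs-½ : ∀ {p q a} → p ≡ ½ * q → abs q ≤ a → abs p ≤ ½ * a
abs-½ refl q≤a = abs-* {½} ℚ.≤-refl q≤a

half^ : ℕ → ℚ
half^ zero    = 1ℚ
half^ (suc n) = ½ * half^ n

half^-pos : ∀ n → 0ℚ < half^ n
half^-pos zero    = ℚ.positive⁻¹ 1ℚ
half^-pos (suc n) = half-pos (half^-pos n)

half^≤1 : ∀ n → half^ n ≤ 1ℚ
half^≤1 zero    = ℚ.≤-refl
half^≤1 (suc n) = ℚ.≤-trans (mulˡ-≤ 0≤½ (half^≤1 n)) (ℚ.p≤p⊔q ½ 1ℚ)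

fromℕℚ : ℕ → ℚ
fromℕℚ n = + n ℚ./ 1

fromℕℚ-suc : ∀ n → fromℕℚ (suc n) ≡ 1ℚ + fromℕℚ n
fromℕℚ-suc n = ℚ.toℚᵘ-injective (begin
  toℚᵘ (fromℕℚ (suc n))           ≈⟨ ℚ.toℚᵘ-fromℚᵘ (ℚᵘ.mkℚᵘ (+ suc n) 0) ⟩
  ℚᵘ.mkℚᵘ (+ suc n) 0             ≈⟨ ℚᵘ.*≡* (cong (ℤ._* + 1) (cong (λ m → + 1 ℤ.+ m) (sym (ℤ.*-identityʳ (+ n))))) ⟩
  ℚᵘ.1ℚᵘ ℚᵘ.+ ℚᵘ.mkℚᵘ (+ n) 0     ≈⟨ ℚᵘ.+-congʳ ℚᵘ.1ℚᵘ (ℚᵘ.≃-sym (ℚ.toℚᵘ-fromℚᵘ (ℚᵘ.mkℚᵘ (+ n) 0))) ⟩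
  ℚᵘ.1ℚᵘ ℚᵘ.+ toℚᵘ (fromℕℚ n)     ≈⟨ ℚᵘ.≃-sym (ℚ.toℚᵘ-homo-+ 1ℚ (fromℕℚ n)) ⟩
  toℚᵘ (1ℚ + fromℕℚ n)            ∎)
  where open import Relation.Binary.Reasoning.Setoid ℚᵘ.≃-setoid

archimedean : ∀ q → ∃[ n ] q ≤ fromℕℚ n
archimedean q@(mkℚ i d _) = ℤ.∣ i ∣ , ℚ.toℚᵘ-cancel-≤
  (ℚᵘ.≤-respʳ-≃ (ℚᵘ.≃-sym (ℚ.toℚᵘ-fromℚᵘ (ℚᵘ.mkℚᵘ (+ ℤ.∣ i ∣) 0))) (ℚᵘ.*≤* (lem i)))
  where
  lem : ∀ i → i ℤ.* + 1 ℤ.≤ + ℤ.∣ i ∣ ℤ.* + suc d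
  lem (+ n) = subst₂ ℤ._≤_ (ℤ.pos-* n 1) (ℤ.pos-* n (suc d))
    (ℤ.+≤+ (ℕ.*-monoʳ-≤ n (ℕ.s≤s ℕ.z≤n)))
  lem ℤ.-[1+ n ] = ℤ.-≤+

half^-fromℕℚ : ∀ n → fromℕℚ n * half^ n ≤ 1ℚ
half^-fromℕℚ zero    = ℚ.p≤p⊔q 0ℚ 1ℚ
half^-fromℕℚ (suc n) = begin
  fromℕℚ (suc n) * (½ * half^ n)                ≡⟨ cong (_* (½ * half^ n)) (fromℕℚ-suc n) ⟩
  (1ℚ + fromℕℚ n) * (½ * half^ n)               ≡⟨ ring (fromℕℚ n) (half^ n) ⟩
  ½ * half^ n + ½ * (fromℕℚ n * half^ n)        ≤⟨ ℚ.+-mono-≤ (mulˡ-≤ 0≤½ (half^≤1 n)) (mulˡ-≤ 0≤½ (half^-fromℕℚ n)) ⟩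
  ½ * 1ℚ + ½ * 1ℚ                               ≡⟨⟩
  1ℚ                                            ∎
  where
  open +-*-Solver using (solve; con; _:+_; _:*_; _:=_)
  ring : ∀ a h → (1ℚ + a) * (½ * h) ≡ ½ * h + ½ * (a * h)
  ring = solve 2 (λ a h → (con 1ℚ :+ a) :* (con ½ :* h) := con ½ :* h :+ con ½ :* (a :* h)) refl
  open ℚ.≤-Reasoning

shrink : ∀ C {ε} → 0ℚ < ε → ∃[ n ] C * half^ n ≤ ε
shrink C {ε} 0<ε = n , (begin
  C * half^ n                   ≡⟨ cong (_* half^ n) C≡ ⟩
  ε * (C * (1/ ε)) * half^ n    ≤⟨ mulʳ-≤ (ℚ.<⇒≤ (half^-pos n)) (mulˡ-≤ (ℚ.<⇒≤ 0<ε) (proj₂ (archimedean (C * (1/ ε))))) ⟩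
  ε * fromℕℚ n * half^ n        ≡⟨ ℚ.*-assoc ε (fromℕℚ n) (half^ n) ⟩
  ε * (fromℕℚ n * half^ n)      ≤⟨ mulˡ-≤ (ℚ.<⇒≤ 0<ε) (half^-fromℕℚ n) ⟩
  ε * 1ℚ                        ≡⟨ ℚ.*-identityʳ ε ⟩
  ε                             ∎)
  where
  open ℚ.≤-Reasoning
  instance
    _ : ℚ.NonZero ε
    _ = ℚ.>-nonZero 0<ε
  n = proj₁ (archimedean (C * (1/ ε)))
  C≡ : C ≡ ε * (C * (1/ ε))
  C≡ = sym (trans (solve 3 (λ e c i → e :* (c :* i) := c :* (e :* i)) refl ε C (1/ ε))
                  (trans (cong (C *_) (ℚ.*-inverseʳ ε)) (ℚ.*-identityʳ C)))
    where open +-*-Solver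

-- Cauchy sequences of rationals, with equality _≃_.
record ℝ : Set where
  field
    seq    : ℕ → ℚ
    cauchy : ∀ ε → 0ℚ < ε → ∃[ N ] ∀ m n → N ℕ.≤ m → N ℕ.≤ n → abs (seq m - seq n) ≤ ε

open ℝ public

infix 4 _≤ℝ_ _<ℝ_ _≃_

_≤ℝ_ : Rel ℝ 0ℓ
x ≤ℝ y = ∀ ε → 0ℚ < ε → ∃[ N ] ∀ n → N ℕ.≤ n → seq x n ≤ seq y n + ε

_<ℝ_ : Rel ℝ 0ℓ
x <ℝ y = ∃[ δ ] 0ℚ < δ × ∃[ N ] ∀ n → N ℕ.≤ n → seq x n + δ ≤ seq y n

_≃_ : Rel ℝ 0ℓ
x ≃ y = x ≤ℝ y × y ≤ℝ x

fromℚ : ℚ → ℝ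
fromℚ q = record
  { seq    = λ _ → q
  ; cauchy = λ ε 0<ε → 0 , λ _ _ _ _ → subst (_≤ ε) (cong abs (sym (ℚ.+-inverseʳ q))) (ℚ.<⇒≤ 0<ε)
  }

fromℤ : ℤ → ℝ
fromℤ i = fromℚ (i ℚ./ 1)

fromℕ : ℕ → ℝ
fromℕ n = fromℤ (+ n)

0ℝ 1ℝ : ℝ
0ℝ = fromℚ 0ℚ
1ℝ = fromℚ 1ℚ

1≤⇒0< : ∀ {x} → 1ℝ ≤ℝ x → 0ℝ <ℝ x
1≤⇒0< {x} 1≤x = ½ , 0<½ , proj₁ (1≤x ½ 0<½) , λ n N≤n →
  subst₂ _≤_ refl
    (solve 1 (λ a → (a :+ con ½) :+ con (- ½) := a) refl (seq x n))
    (ℚ.+-monoˡ-≤ (- ½) (proj₂ (1≤x ½ 0<½) n N≤n))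
  where open +-*-Solver

bounded : ∀ x → ∃[ B ] 0ℚ ≤ B × ∃[ N ] ∀ n → N ℕ.≤ n → abs (seq x n) ≤ B
bounded x = abs (seq x N) + 1ℚ , add-nonNeg (ℚ.0≤∣p∣ (seq x N)) (ℚ.p≤p⊔q 0ℚ 1ℚ) , N , λ n N≤n →
  abs-+ {seq x n} {seq x N} {seq x n - seq x N}
    (solve 2 (λ a b → a := b :+ (a :- b)) refl (seq x n) (seq x N))
    ℚ.≤-refl (proj₂ c n N N≤n ℕ.≤-refl)
  where
  open +-*-Solver
  c = cauchy x 1ℚ (ℚ.positive⁻¹ 1ℚ)
  N = proj₁ c

mul-near : ∀ a b a′ b′ {B C δ} → abs a ≤ B → abs b′ ≤ C → abs (a - a′) ≤ δ → abs (b - b′) ≤ δ →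
  abs (a * b - a′ * b′) ≤ (B + C) * δ
mul-near a b a′ b′ {B} {C} {δ} a≤B b′≤C a-near b-near = subst (_ ≤_) (sym (ℚ.*-distribʳ-+ δ B C))
  (abs-+ {a * b - a′ * b′} {a * (b - b′)} {b′ * (a - a′)}
    (solve 4 (λ a b a′ b′ → a :* b :- a′ :* b′ := a :* (b :- b′) :+ b′ :* (a :- a′)) refl a b a′ b′)
    (abs-* {a} {b - b′} a≤B b-near)
    (abs-* {b′} {a - a′} b′≤C a-near))
  where open +-*-Solver

⊔-split : ∀ a b {n} → a ℕ.⊔ b ℕ.≤ n → a ℕ.≤ n × b ℕ.≤ n
⊔-split a b p = ℕ.m⊔n≤o⇒m≤o a b p , ℕ.m⊔n≤o⇒n≤o a b p

infixl 7 _*ℝ_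

_*ℝ_ : ℝ → ℝ → ℝ
x *ℝ y = record
  { seq    = λ n → seq x n * seq y n
  ; cauchy = λ ε 0<ε →
      let B , _ , N₁ , x≤B = bounded x
          C , _ , N₂ , y≤C = bounded y
          k , small        = shrink (B + C) 0<ε
          N₃ , x-near      = cauchy x (half^ k) (half^-pos k)
          N₄ , y-near      = cauchy y (half^ k) (half^-pos k)
      in (N₁ ℕ.⊔ N₂) ℕ.⊔ (N₃ ℕ.⊔ N₄) , λ m n N≤m N≤n →
        let m₁₂ , m₃₄ = ⊔-split (N₁ ℕ.⊔ N₂) (N₃ ℕ.⊔ N₄) N≤m
            n₁₂ , n₃₄ = ⊔-split (N₁ ℕ.⊔ N₂) (N₃ ℕ.⊔ N₄) N≤n
            m₁ , _    = ⊔-split N₁ N₂ m₁₂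
            _ , n₂    = ⊔-split N₁ N₂ n₁₂
            m₃ , m₄   = ⊔-split N₃ N₄ m₃₄
            n₃ , n₄   = ⊔-split N₃ N₄ n₃₄
        in ℚ.≤-trans
             (mul-near (seq x m) (seq y m) (seq x n) (seq y n)
               (x≤B m m₁) (y≤C n n₂) (x-near m n m₃ n₃) (y-near m n m₄ n₄))
             small
  }

-- Right-endpoint Riemann sum of f from a to b over 2 ^ k equal pieces.
riemann : (ℚ → ℚ) → ℕ → ℚ → ℚ → ℚ
riemann f zero    a b = (b - a) * f b
riemann f (suc k) a b = riemann f k a mid + riemann f k mid b
  where mid = ½ * (a + b)

module RiemannEstimates (f : ℚ → ℚ) {M K : ℚ} (0≤M : 0ℚ ≤ M) (0≤K : 0ℚ ≤ K)
  (f-bounded : ∀ t → abs (f t) ≤ M)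
  (f-lipschitz : ∀ s t → abs (f s - f t) ≤ K * abs (s - t)) where

  open +-*-Solver

  f-near : ∀ s t {e} → abs (s - t) ≤ e → abs (f s - f t) ≤ K * e
  f-near s t s-t≤e = ℚ.≤-trans (f-lipschitz s t) (mulˡ-≤ 0≤K s-t≤e)

  mid-near : ∀ {a b c D} → abs (a - c) ≤ D → abs (b - c) ≤ D → abs (½ * (a + b) - c) ≤ D
  mid-near {a} {b} {c} {D} a≤ b≤ = subst (abs (½ * (a + b) - c) ≤_) (halves D)
    (abs-+ {½ * (a + b) - c} {½ * (a - c)} {½ * (b - c)}
      (solve 3 (λ a b c → con ½ :* (a :+ b) :- c := con ½ :* (a :- c) :+ con ½ :* (b :- c)) refl a b c)
      (abs-½ {q = a - c} refl a≤) (abs-½ {q = b - c} refl b≤))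

  left-half : ∀ {a b d} → abs (b - a) ≤ d → abs (½ * (a + b) - a) ≤ ½ * d
  left-half {a} {b} = abs-½ {q = b - a}
    (solve 2 (λ a b → con ½ :* (a :+ b) :- a := con ½ :* (b :- a)) refl a b)

  right-half : ∀ {a b d} → abs (b - a) ≤ d → abs (b - ½ * (a + b)) ≤ ½ * d
  right-half {a} {b} = abs-½ {q = b - a}
    (solve 2 (λ a b → b :- con ½ :* (a :+ b) := con ½ :* (b :- a)) refl a b)

  -- All sample points lie within D of c.
  rectangle : ∀ k {a b c d D} → abs (b - a) ≤ d → abs (a - c) ≤ D → abs (b - c) ≤ D →
    abs (riemann f k a b - (b - a) * f c) ≤ d * (K * D)
  rectangle zero {a} {b} {c} {d} {D} ba ac bc =
    subst (λ z → abs z ≤ d * (K * D))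
      (solve 3 (λ u v w → u :* (v :- w) := u :* v :- u :* w) refl (b - a) (f b) (f c))
      (abs-* {b - a} {f b - f c} ba (f-near b c bc))
  rectangle (suc k) {a} {b} {c} {d} {D} ba ac bc =
    subst (abs (riemann f (suc k) a b - (b - a) * f c) ≤_)
      (solve 2 (λ d e → con ½ :* d :* e :+ con ½ :* d :* e := d :* e) refl d (K * D))
      (abs-+ {riemann f (suc k) a b - (b - a) * f c} {l - (m - a) * f c} {r - (b - m) * f c}
        (solve 6 (λ l r a b m w → (l :+ r) :- (b :- a) :* w :=
                                  (l :- (m :- a) :* w) :+ (r :- (b :- m) :* w)) refl l r a b m (f c))
        (rectangle k (left-half {a} {b} ba) ac mc)
        (rectangle k (right-half {a} {b} ba) mc bc))
    where
    m  = ½ * (a + b)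
    l  = riemann f k a m
    r  = riemann f k m b
    mc = mid-near {a} {b} {c} ac bc

  refine : ∀ k j {a b d} → 0ℚ ≤ d → abs (b - a) ≤ d →
    abs (riemann f (k ℕ.+ j) a b - riemann f k a b) ≤ d * (K * d) * half^ k
  refine zero j {a} {b} {d} 0≤d ba =
    subst (abs (riemann f j a b - (b - a) * f b) ≤_) (sym (ℚ.*-identityʳ (d * (K * d))))
      (rectangle j ba (subst (_≤ d) (abs-sym b a) ba)
        (subst (_≤ d) (cong abs (sym (ℚ.+-inverseʳ b))) 0≤d))
  refine (suc k) j {a} {b} {d} 0≤d ba =
    subst (abs (riemann f (suc k ℕ.+ j) a b - riemann f (suc k) a b) ≤_)
      (solve 3 (λ d K h → con ½ :* d :* (K :* (con ½ :* d)) :* h :+ con ½ :* d :* (K :* (con ½ :* d)) :* h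
                          := d :* (K :* d) :* (con ½ :* h)) refl d K (half^ k))
      (abs-+ {riemann f (suc k ℕ.+ j) a b - riemann f (suc k) a b} {l′ - l} {r′ - r}
        (solve 4 (λ l r l′ r′ → (l′ :+ r′) :- (l :+ r) := (l′ :- l) :+ (r′ :- r)) refl l r l′ r′)
        (refine k j (mul-nonNeg 0≤½ 0≤d) (left-half {a} {b} ba))
        (refine k j (mul-nonNeg 0≤½ 0≤d) (right-half {a} {b} ba)))
    where
    m  = ½ * (a + b)
    l  = riemann f k a m
    r  = riemann f k m b
    l′ = riemann f (k ℕ.+ j) a m
    r′ = riemann f (k ℕ.+ j) m b

  endpoints : ∀ k {a b a′ b′ E F d} → abs (a - a′) ≤ E → abs (b - b′) ≤ E →
    abs ((b - a) - (b′ - a′)) ≤ F → abs (b′ - a′) ≤ d →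
    abs (riemann f k a b - riemann f k a′ b′) ≤ F * M + d * (K * E)
  endpoints zero {a} {b} {a′} {b′} aa bb ww ba =
    abs-+ {(b - a) * f b - (b′ - a′) * f b′} {((b - a) - (b′ - a′)) * f b} {(b′ - a′) * (f b - f b′)}
      (solve 4 (λ u v w z → u :* v :- w :* z := (u :- w) :* v :+ w :* (v :- z)) refl
        (b - a) (f b) (b′ - a′) (f b′))
      (abs-* {(b - a) - (b′ - a′)} {f b} ww (f-bounded b))
      (abs-* {b′ - a′} {f b - f b′} ba (f-near b b′ bb))
  endpoints (suc k) {a} {b} {a′} {b′} {E} {F} {d} aa bb ww ba =
    subst (abs (riemann f (suc k) a b - riemann f (suc k) a′ b′) ≤_)
      (solve 4 (λ F M d e → (con ½ :* F :* M :+ con ½ :* d :* e) :+ (con ½ :* F :* M :+ con ½ :* d :* e)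
                            := F :* M :+ d :* e) refl F M d (K * E))
      (abs-+ {riemann f (suc k) a b - riemann f (suc k) a′ b′} {l - l′} {r - r′}
        (solve 4 (λ l r l′ r′ → (l :+ r) :- (l′ :+ r′) := (l :- l′) :+ (r :- r′)) refl l r l′ r′)
        (endpoints k aa mm
          (abs-½ {q = (b - a) - (b′ - a′)}
            (solve 4 (λ a b a′ b′ → (con ½ :* (a :+ b) :- a) :- (con ½ :* (a′ :+ b′) :- a′)
                                    := con ½ :* ((b :- a) :- (b′ :- a′))) refl a b a′ b′) ww)
          (left-half {a′} {b′} ba))
        (endpoints k mm bb
          (abs-½ {q = (b - a) - (b′ - a′)}
            (solve 4 (λ a b a′ b′ → (b :- con ½ :* (a :+ b)) :- (b′ :- con ½ :* (a′ :+ b′))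
                                    := con ½ :* ((b :- a) :- (b′ :- a′))) refl a b a′ b′) ww)
          (right-half {a′} {b′} ba)))
    where
    m  = ½ * (a + b)
    m′ = ½ * (a′ + b′)
    l  = riemann f k a m
    r  = riemann f k m b
    l′ = riemann f k a′ m′
    r′ = riemann f k m′ b′
    mm : abs (m - m′) ≤ E
    mm = subst (abs (m - m′) ≤_) (halves E)
      (abs-+ {m - m′} {½ * (a - a′)} {½ * (b - b′)}
        (solve 4 (λ a b a′ b′ → con ½ :* (a :+ b) :- con ½ :* (a′ :+ b′)
                                := con ½ :* (a :- a′) :+ con ½ :* (b :- b′)) refl a b a′ b′)
        (abs-½ {q = a - a′} refl aa) (abs-½ {q = b - b′} refl bb))

  integral-from-1 : ℝ → ℝ
  integral-from-1 x = record
    { seq    = λ n → riemann f n 1ℚ (seq x n)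
    ; cauchy = λ ε 0<ε →
        let B , 0≤B , N₁ , x≤B = bounded x
            d                  = B + 1ℚ
            k , smallₑ         = shrink (M + d * K) (half-pos 0<ε)
            N₂ , x-near        = cauchy x (half^ k) (half^-pos k)
            N₃ , smallᵣ        = shrink (d * (K * d)) (half-pos (half-pos 0<ε))
        in N₁ ℕ.⊔ (N₂ ℕ.⊔ N₃) , λ m n N≤m N≤n →
          let _ , m₂₃   = ⊔-split N₁ (N₂ ℕ.⊔ N₃) N≤m
              m₂ , m₃   = ⊔-split N₂ N₃ m₂₃
              n₁ , n₂₃  = ⊔-split N₁ (N₂ ℕ.⊔ N₃) N≤n
              n₂ , n₃   = ⊔-split N₂ N₃ n₂₃
          in close {ε} {M + d * K} {d * (K * d)} {half^ k} {d} N₃ m₃ n₃ refl refl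
               (add-nonNeg 0≤B (ℚ.p≤p⊔q 0ℚ 1ℚ)) (ℚ.<⇒≤ (half^-pos k))
               (x-near m n m₂ n₂) (length-≤ (x≤B n n₁)) smallₑ smallᵣ
    }
    where
    length-≤ : ∀ {b B} → abs b ≤ B → abs (b - 1ℚ) ≤ B + 1ℚ
    length-≤ {b} b≤B = abs-+ {b - 1ℚ} {b} { - 1ℚ} refl b≤B ℚ.≤-refl

    close : ∀ {ε C D δ d m n b b′} N → N ℕ.≤ m → N ℕ.≤ n →
      C ≡ M + d * K → D ≡ d * (K * d) → 0ℚ ≤ d → 0ℚ ≤ δ →
      abs (b - b′) ≤ δ → abs (b′ - 1ℚ) ≤ d →
      C * δ ≤ ½ * ε → D * half^ N ≤ ½ * (½ * ε) →
      abs (riemann f m 1ℚ b - riemann f n 1ℚ b′) ≤ ε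
    close {ε} {_} {_} {δ} {d} {m} {n} {b} {b′} N N≤m N≤n refl refl 0≤d 0≤δ bb b′1 smallₑ smallᵣ =
      subst (abs (R m b - R n b′) ≤_) (halves ε)
        (abs-+ {R m b - R n b′} {R m b - R m b′} {R m b′ - R n b′}
          (solve 3 (λ u v w → u :- w := (u :- v) :+ (v :- w)) refl (R m b) (R m b′) (R n b′))
          (ℚ.≤-trans
            (endpoints m {1ℚ} {b} {1ℚ} {b′} 0≤δ bb
              (subst (λ z → abs z ≤ δ)
                (solve 2 (λ b b′ → b :- b′ := (b :- con 1ℚ) :- (b′ :- con 1ℚ)) refl b b′) bb)
              b′1)
            (subst (_≤ ½ * ε)
              (solve 4 (λ M d K δ → (M :+ d :* K) :* δ := δ :* M :+ d :* (K :* δ)) refl M d K δ)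
              smallₑ))
          (subst (abs (R m b′ - R n b′) ≤_) (halves (½ * ε))
            (abs-+ {R m b′ - R n b′} {R m b′ - R N b′} {R N b′ - R n b′}
              (solve 3 (λ u v w → u :- w := (u :- v) :+ (v :- w)) refl (R m b′) (R N b′) (R n b′))
              (tail N≤m)
              (subst (_≤ ½ * (½ * ε)) (abs-sym (R n b′) (R N b′)) (tail N≤n)))))
      where
      R : ℕ → ℚ → ℚ
      R k = riemann f k 1ℚ
      tail : ∀ {m} → N ℕ.≤ m → abs (R m b′ - R N b′) ≤ ½ * (½ * ε)
      tail N≤m = ℚ.≤-trans
        (subst (λ k → abs (R k b′ - R N b′) ≤ d * (K * d) * half^ N) (ℕ.m+[n∸m]≡n N≤m)
          (refine N _ 0≤d b′1))
        smallᵣ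

module ClampedReciprocal {δ : ℚ} (0<δ : 0ℚ < δ) where

  private
    instance
      clamped-nonZero : ∀ {t} → ℚ.NonZero (δ ⊔ t)
      clamped-nonZero {t} = ℚ.>-nonZero (ℚ.<-≤-trans 0<δ (ℚ.p≤p⊔q δ t))

      δ-nonZero : ℚ.NonZero δ
      δ-nonZero = ℚ.>-nonZero 0<δ

  recip : ℚ → ℚ
  recip t = 1/ (δ ⊔ t)

  M : ℚ
  M = 1/ δ

  1/-pos : ∀ {p} → 0ℚ < p → .⦃ nz : ℚ.NonZero p ⦄ → 0ℚ < (1/ p) ⦃ nz ⦄
  1/-pos {p} 0<p ⦃ nz ⦄ = ℚ.positive⁻¹ ((1/ p) ⦃ nz ⦄) ⦃ ℚ.1/pos⇒pos p ⦃ ℚ.positive 0<p ⦄ ⦄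

  0≤M : 0ℚ ≤ M
  0≤M = ℚ.<⇒≤ (1/-pos 0<δ)

  recip-pos : ∀ t → 0ℚ < recip t
  recip-pos t = 1/-pos (ℚ.<-≤-trans 0<δ (ℚ.p≤p⊔q δ t))

  recip≤M : ∀ t → recip t ≤ M
  recip≤M t = ℚ.*-cancelˡ-≤-pos δ ⦃ ℚ.positive 0<δ ⦄ (begin
    δ * recip t        ≤⟨ mulʳ-≤ (ℚ.<⇒≤ (recip-pos t)) (ℚ.p≤p⊔q δ t) ⟩
    (δ ⊔ t) * recip t  ≡⟨ ℚ.*-inverseʳ (δ ⊔ t) ⟩
    1ℚ                 ≡⟨ ℚ.*-inverseʳ δ ⟨
    δ * M              ∎)
    where open ℚ.≤-Reasoning

  abs-recip : ∀ t → abs (recip t) ≤ M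
  abs-recip t = subst (_≤ M) (sym (ℚ.0≤p⇒∣p∣≡p (ℚ.<⇒≤ (recip-pos t)))) (recip≤M t)

  ⊔-mono-near : ∀ s t → (δ ⊔ s) - (δ ⊔ t) ≤ abs (s - t)
  ⊔-mono-near s t = subst ((δ ⊔ s) - (δ ⊔ t) ≤_)
    (solve 2 (λ u e → (u :+ e) :- u := e) refl (δ ⊔ t) (abs (s - t)))
    (ℚ.+-monoˡ-≤ (- (δ ⊔ t)) (ℚ.⊔-lub
      (subst (_≤ (δ ⊔ t) + abs (s - t)) (ℚ.+-identityʳ δ)
        (ℚ.+-mono-≤ (ℚ.p≤p⊔q δ t) (ℚ.0≤∣p∣ (s - t))))
      (subst (_≤ (δ ⊔ t) + abs (s - t))
        (solve 2 (λ s t → t :+ (s :- t) := s) refl s t)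
        (ℚ.+-mono-≤ (ℚ.p≤q⊔p δ t) (p≤abs (s - t))))))
    where open +-*-Solver

  ⊔-near : ∀ s t → abs ((δ ⊔ s) - (δ ⊔ t)) ≤ abs (s - t)
  ⊔-near s t = abs-≤ {(δ ⊔ s) - (δ ⊔ t)} (⊔-mono-near s t)
    (subst₂ _≤_ (solve 2 (λ u v → v :- u := :- (u :- v)) refl (δ ⊔ s) (δ ⊔ t)) (abs-sym t s)
      (⊔-mono-near t s))
    where open +-*-Solver

  recip-lipschitz : ∀ s t → abs (recip s - recip t) ≤ M * M * abs (s - t)
  recip-lipschitz s t = subst₂ (λ z e → abs z ≤ e)
    (difference {u} {v} {recip s} {recip t} (ℚ.*-inverseʳ u) (ℚ.*-inverseʳ v))
    (cong (M * M *_) (abs-sym t s))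
    (abs-* {recip s * recip t} {v - u} (abs-* {recip s} {recip t} (abs-recip s) (abs-recip t)) (⊔-near t s))
    where
    open +-*-Solver
    u = δ ⊔ s
    v = δ ⊔ t
    difference : ∀ {u v p q} → u * p ≡ 1ℚ → v * q ≡ 1ℚ → p * q * (v - u) ≡ p - q
    difference {u} {v} {p} {q} up vq = begin
      p * q * (v - u)            ≡⟨ solve 4 (λ u v p q → p :* q :* (v :- u) := p :* (v :* q) :- q :* (u :* p)) refl u v p q ⟩
      p * (v * q) - q * (u * p)  ≡⟨ cong₂ (λ a b → p * a - q * b) vq up ⟩
      p * 1ℚ - q * 1ℚ            ≡⟨ cong₂ _-_ (ℚ.*-identityʳ p) (ℚ.*-identityʳ q) ⟩
      p - q                      ∎
      where open ≡-Reasoning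

0<⊓1 : ∀ {δ} → 0ℚ < δ → 0ℚ < δ ⊓ 1ℚ
0<⊓1 {δ} 0<δ with ℚ.⊓-sel δ 1ℚ
... | inj₁ eq = subst (0ℚ <_) (sym eq) 0<δ
... | inj₂ eq = subst (0ℚ <_) (sym eq) (ℚ.positive⁻¹ 1ℚ)

-- The integral of 1/t from 1 to x.  With δ a positive lower bound of x, every t
-- between 1 and x satisfies δ ⊓ 1 ≤ t, so clamping t from below at δ ⊓ 1 keeps
-- the integrand Lipschitz without changing the integral.
log : (x : ℝ) → 0ℝ <ℝ x → ℝ
log x (δ , 0<δ , _) = integral-from-1 x
  where
  open ClampedReciprocal (0<⊓1 0<δ)
  open RiemannEstimates recip 0≤M (mul-nonNeg 0≤M 0≤M) abs-recip recip-lipschitz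

infix 4 _∈Ω_

-- f(c) ∈ Ω(h(c)) as c → ∞, for comparison functions h defined on positive reals.
_∈Ω_ : (ℝ → ℝ) → ((c : ℝ) → 0ℝ <ℝ c → ℝ) → Set
f ∈Ω h = ∃[ ε ] 0ℝ <ℝ ε × ∃[ c₀ ] ∀ c (0<c : 0ℝ <ℝ c) → c₀ ≤ℝ c → ε *ℝ h c 0<c ≤ℝ f c

record Graph : Set where
  field
    order      : ℕ
    adj        : Fin order → Fin order → Bool
    adj-sym    : ∀ u v → adj u v ≡ adj v u
    adj-irrefl : ∀ v → adj v v ≡ false

  Vertex : Set
  Vertex = Fin order

  infix 4 _~_

  _~_ : Rel Vertex 0ℓ
  u ~ v = T (adj u v)

record Subgraph (G : Graph) : Set where
  open Graph G
  field
    vertices  : Subset order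
    edge      : Vertex → Vertex → Bool
    edge-sym  : ∀ u v → edge u v ≡ edge v u
    edge⇒adj  : ∀ u v → T (edge u v) → u ~ v
    endpoint  : ∀ u v → T (edge u v) → u ∈ vertices

data Walk {A : Set} (_~_ : Rel A 0ℓ) : A → A → ℕ → Set where
  []  : ∀ {x} → Walk _~_ x x 0
  _∷_ : ∀ {x y z k} → x ~ y → Walk _~_ y z k → Walk _~_ x z (suc k)

RadiusAtMost : {G : Graph} → Subgraph G → ℕ → Set
RadiusAtMost H r = ∃[ v ] v ∈ vertices × ∀ u → u ∈ vertices →
  ∃[ k ] k ℕ.≤ r × Walk (λ x y → T (edge x y)) v u k
  where open Subgraph H

-- f_G(r) = m.  The null graph has no subgraph of finite radius, so it has no
-- such m, and any upper bound on its growth holds vacuously.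
IsGrowth : Graph → ℕ → ℕ → Set
IsGrowth G r m =
  (Σ[ H ∈ Subgraph G ] RadiusAtMost H r × ∣ Subgraph.vertices H ∣ ≡ m) ×
  (∀ (H : Subgraph G) → RadiusAtMost H r → ∣ Subgraph.vertices H ∣ ℕ.≤ m)

module _ (G : Graph) where
  open Graph G

  IsConnected : Set
  IsConnected = ∀ u v → Star _~_ u v

  -- v ∷ vs lists the distinct vertices of a cycle in order.
  IsCycle : Vertex → List Vertex → Set
  IsCycle v vs = 2 ℕ.≤ length vs × Unique (v ∷ vs) × Linked _~_ (v ∷ (vs ∷ʳ v))

  IsTree : Set
  IsTree = 1 ℕ.≤ order × IsConnected × (∀ v vs → ¬ IsCycle v vs)

record TreeDecomposition (G : Graph) : Set where
  open Graph G using (order; Vertex; _~_)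
  field
    tree   : Graph
    isTree : IsTree tree

  open Graph tree public using () renaming (order to nodes; Vertex to Node; _~_ to _~ᵀ_)

  field
    bag            : Node → Subset order
    edge-covered   : ∀ u v → u ~ v → ∃[ x ] u ∈ bag x × v ∈ bag x
    vertex-covered : ∀ v → ∃[ x ] v ∈ bag x
    bags-connected : ∀ v x y → v ∈ bag x → v ∈ bag y →
      Star (λ a b → a ~ᵀ b × v ∈ bag a × v ∈ bag b) x y

  maxBagSize : ℕ
  maxBagSize = Vector.foldr ℕ._⊔_ 0 (λ x → ∣ bag x ∣)

  width : ℤ
  width = + maxBagSize ℤ.- 1ℤ

-- tw(G) = t; t is an integer because the null graph has treewidth -1.
IsTreewidth : Graph → ℤ → Set
IsTreewidth G t =
  (Σ[ D ∈ TreeDecomposition G ] TreeDecomposition.width D ≡ t) ×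
  (∀ (D : TreeDecomposition G) → t ℤ.≤ TreeDecomposition.width D)

{-# OPTIONS --safe #-}
module Submission where

-- If every vertex of a graph on n vertices has fewer than B neighbours, then its
-- growth is at most min (n, B ^ r).  For n = c log_B c this is at most c r: if
-- r < log_B c then B ^ r ≤ c, and otherwise n ≤ c r.  So it suffices to find, for
-- one B and all large n, such a graph whose treewidth is linear in n.
--
-- The graph is an expander: any two disjoint sets of at least n / 5 vertices are
-- joined by an edge.  It is built greedily.  As few vertices are saturated at any
-- time, averaging gives an edge between unsaturated vertices that joins a constant
-- fraction of the pairs (A , B) not yet joined, so O(n) edges join all 4 ^ n pairs.
--
-- Suppose all bags of a tree-decomposition of the expander have at most n / 5
-- vertices.  Contract leaves of the tree one by one into their parents, recording
-- at each node x the set U of vertices that occur in the bags contracted into x but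
-- not in the bag of x.  No edge leaves U except into the bag of x, so U must stay
-- smaller than n / 5 throughout; but at the last node, U and the bag are everything.

module Combinatorics where

  open import Data.Nat.Properties hiding (_≟_)
  open import Algebra.Properties.Semiring.Sum +-*-semiring
    using (sum; sum-cong-≗; ∑-distrib-+; *-distribˡ-sum; *-distribʳ-sum)
  open import Data.Bool.Base using (Bool; true; false; T; not; if_then_else_; _∧_; _∨_)
  open import Data.Bool.Properties using (T-∧; T-∨; ∧-comm; ∨-comm)
  open import Data.Empty using (⊥; ⊥-elim)
  open import Data.Fin.Base using (Fin; zero; suc; fromℕ<)
  open import Data.Fin.Properties using (_≟_; any?)
  open import Data.Fin.Subset using (Subset; ∣_∣; inside; outside; ⊤) renaming (_∈_ to _∈ₛ_)
  open import Data.Fin.Subset.Properties using (∈⊤)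
  import Data.Integer.Base as ℤ
  import Data.Integer.Properties as ℤ
  open import Data.List.Base
    using (List; []; _∷_; _∷ʳ_; _++_; length; map; filter; filterᵇ; cartesianProductWith; allFin)
  open import Data.List.Membership.Propositional using (_∈_; _∉_)
  open import Data.List.Membership.Propositional.Properties
    using (∈-cartesianProductWith⁺; ∈-filter⁺; ∈-filter⁻; ∈-allFin)
  open import Data.List.Properties using (length-map; length-++; length-filter)
  open import Data.List.Relation.Binary.Subset.Propositional using (_⊆_)
  open import Data.List.Relation.Unary.All as All using (All; []; _∷_)
  import Data.List.Relation.Unary.All.Properties as All
  open import Data.List.Relation.Unary.AllPairs using ([]; _∷_)
  open import Data.List.Relation.Unary.Any as List using (here; there)
  open import Data.List.Relation.Unary.Linked using (Linked; [-]; _∷_)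
  open import Data.List.Relation.Unary.Unique.Propositional using (Unique)
  import Data.List.Relation.Unary.Unique.Propositional.Properties as Unique
  open import Data.Nat.Base
  open import Data.Nat.Solver using (module +-*-Solver)
  open import Data.Product.Base using (∃; ∃-syntax; Σ-syntax; _×_; _,_; proj₁; proj₂)
  open import Data.Sum.Base using (_⊎_; inj₁; inj₂)
  open import Data.Unit.Base using (tt)
  open import Data.Vec.Base using (Vec; []; _∷_; lookup; tabulate)
  import Data.Vec.Functional as Vector
  open import Data.Vec.Properties using (lookup∘tabulate; []=⇒lookup; lookup⇒[]=)
  open import Defs using
    (Graph; Subgraph; Walk; []; _∷_; RadiusAtMost; IsCycle; IsTree; TreeDecomposition; IsTreewidth)
  open import Function.Base using (_∘_; id)
  open import Function.Bundles using (Equivalence)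
  open import Relation.Binary.Construct.Closure.ReflexiveTransitive using (Star; ε; _◅_)
  open import Relation.Binary.PropositionalEquality
  open import Relation.Nullary.Decidable
    using (Dec; yes; no; does; isYes; T?; toWitness; fromWitness; _×-dec_)
  open import Relation.Nullary.Negation using (¬_; contradiction)

  -- Counting with Boolean predicates on finite sets.

  𝟙 : Bool → ℕ
  𝟙 b = if b then 1 else 0

  -- Opaque so that Agda can infer p from # p.
  opaque
    # : ∀ {n} → (Fin n → Bool) → ℕ
    # p = sum (𝟙 ∘ p)

    #-def : ∀ {n} {p : Fin n → Bool} → # p ≡ sum (𝟙 ∘ p)
    #-def = refl

  T-split : ∀ {a b} → T (a ∧ b) → T a × T b
  T-split = Equivalence.to T-∧

  T-pair : ∀ {a b} → T a → T b → T (a ∧ b)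
  T-pair p q = Equivalence.from T-∧ (p , q)

  T-case : ∀ {a b} → T (a ∨ b) → T a ⊎ T b
  T-case = Equivalence.to T-∨

  T-inj₁ : ∀ {a b} → T a → T (a ∨ b)
  T-inj₁ p = Equivalence.from T-∨ (inj₁ p)

  T-inj₂ : ∀ {a b} → T b → T (a ∨ b)
  T-inj₂ {a} q = Equivalence.from (T-∨ {a}) (inj₂ q)

  T-not : ∀ {a} → ¬ T a → T (not a)
  T-not {false} _ = tt
  T-not {true}  h = ⊥-elim (h tt)

  T-not⁻ : ∀ {a} → T (not a) → ¬ T a
  T-not⁻ {false} _ ()

  𝟙-mono : ∀ {a b} → (T a → T b) → 𝟙 a ≤ 𝟙 b
  𝟙-mono {false}         h = z≤n
  𝟙-mono {true} {true}   h = ≤-refl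
  𝟙-mono {true} {false}  h = ⊥-elim (h tt)

  𝟙-∨ : ∀ {a b c} → (T a → T b ⊎ T c) → 𝟙 a ≤ 𝟙 b + 𝟙 c
  𝟙-∨ {false}               h = z≤n
  𝟙-∨ {true} {true}         h = s≤s z≤n
  𝟙-∨ {true} {false} {true} h = ≤-refl
  𝟙-∨ {true} {false} {false} h with h tt
  ... | inj₁ ()
  ... | inj₂ ()

  sum-mono : ∀ {n} {f g : Fin n → ℕ} → (∀ i → f i ≤ g i) → sum f ≤ sum g
  sum-mono {zero}  h = z≤n
  sum-mono {suc n} h = +-mono-≤ (h zero) (sum-mono (h ∘ suc))

  sum-const : ∀ n {c} → sum {n} (λ _ → c) ≡ n * c
  sum-const zero    = refl
  sum-const (suc n) = cong (_ +_) (sum-const n)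

  opaque
    unfolding #

    #-mono : ∀ {n} {p q : Fin n → Bool} → (∀ i → T (p i) → T (q i)) → # p ≤ # q
    #-mono h = sum-mono (λ i → 𝟙-mono (h i))

    #-∨ : ∀ {n} {p q r : Fin n → Bool} → (∀ i → T (p i) → T (q i) ⊎ T (r i)) → # p ≤ # q + # r
    #-∨ {p = p} {q} {r} h =
      ≤-trans (sum-mono (λ i → 𝟙-∨ {p i} (h i))) (≤-reflexive (∑-distrib-+ (𝟙 ∘ q) (𝟙 ∘ r)))

    #-true : ∀ n → # {n} (λ _ → true) ≡ n
    #-true n = trans (sum-const n) (*-identityʳ n)

    #-false : ∀ n → # {n} (λ _ → false) ≡ 0
    #-false n = trans (sum-const n) (*-zeroʳ n)

  #-all : ∀ {n} {p : Fin n → Bool} → (∀ i → T (p i)) → n ≤ # p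
  #-all {n} h = ≤-trans (≤-reflexive (sym (#-true n))) (#-mono (λ i _ → h i))

  #≤n : ∀ {n} (p : Fin n → Bool) → # p ≤ n
  #≤n {n} p = ≤-trans (#-mono _) (≤-reflexive (#-true n))

  infix 4 _≟ᵇ_

  _≟ᵇ_ : ∀ {n} → Fin n → Fin n → Bool
  u ≟ᵇ v = does (u ≟ v)

  ≟ᵇ⇒≡ : ∀ {n} {u v : Fin n} → T (u ≟ᵇ v) → u ≡ v
  ≟ᵇ⇒≡ {u = u} {v} h with u ≟ v
  ... | yes eq = eq

  ≟ᵇ-refl : ∀ {n} (u : Fin n) → T (u ≟ᵇ u)
  ≟ᵇ-refl u with u ≟ u
  ... | yes _ = tt
  ... | no ¬p = ⊥-elim (¬p refl)

  opaque
    unfolding #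

    #-point : ∀ {n} (u : Fin n) → # (u ≟ᵇ_) ≡ 1
    #-point {suc n} zero    = cong suc (#-false n)
    #-point {suc n} (suc u) = #-point u

  argmax : ∀ {n} (f : Fin (suc n) → ℕ) → ∃[ u ] ∀ v → f v ≤ f u
  argmax {zero}  f = zero , λ { zero → ≤-refl }
  argmax {suc n} f with argmax (f ∘ suc)
  ... | u , max with ≤-total (f zero) (f (suc u))
  ... | inj₁ le = suc u , λ { zero → le ; (suc v) → max v }
  ... | inj₂ ge = zero , λ { zero → ≤-refl ; (suc v) → ≤-trans (max v) ge }

  sum≤max : ∀ {n} (f : Fin (suc n) → ℕ) → ∃[ u ] sum f ≤ suc n * f u
  sum≤max {n} f with argmax f
  ... | u , max = u , ≤-trans (sum-mono max) (≤-reflexive (sum-const (suc n)))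

  -- Filtered lists, double counting and enumeration of words.

  private variable
    A : Set

  length-filterᵇ-∷ : ∀ (p : A → Bool) x xs →
    length (filterᵇ p (x ∷ xs)) ≡ 𝟙 (p x) + length (filterᵇ p xs)
  length-filterᵇ-∷ p x xs with p x
  ... | true  = refl
  ... | false = refl

  length-filterᵇ-mono : ∀ {p q : A → Bool} → (∀ x → T (p x) → T (q x)) → ∀ xs →
    length (filterᵇ p xs) ≤ length (filterᵇ q xs)
  length-filterᵇ-mono h [] = z≤n
  length-filterᵇ-mono {p = p} {q} h (x ∷ xs) =
    subst₂ _≤_ (sym (length-filterᵇ-∷ p x xs)) (sym (length-filterᵇ-∷ q x xs)) (+-mono-≤ (𝟙-mono (h x)) (length-filterᵇ-mono h xs))

  length-filterᵇ-∧ : ∀ (p q : A → Bool) xs →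
    length (filterᵇ q (filterᵇ p xs)) ≡ length (filterᵇ (λ x → p x ∧ q x) xs)
  length-filterᵇ-∧ p q [] = refl
  length-filterᵇ-∧ p q (x ∷ xs) with p x
  ... | false = length-filterᵇ-∧ p q xs
  ... | true  with q x
  ...   | false = length-filterᵇ-∧ p q xs
  ...   | true  = cong suc (length-filterᵇ-∧ p q xs)

  length-filterᵇ-not : ∀ (p : A → Bool) xs →
    length (filterᵇ p xs) + length (filterᵇ (not ∘ p) xs) ≡ length xs
  length-filterᵇ-not p [] = refl
  length-filterᵇ-not p (x ∷ xs) with p x
  ... | true  = cong suc (length-filterᵇ-not p xs)
  ... | false = trans (+-suc _ _) (cong suc (length-filterᵇ-not p xs))

  -- Double counting: if every x satisfies at least c of the n properties, then
  -- some property holds for at least a fraction c / n of all x.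
  popular : ∀ {n} .{{_ : NonZero n}} (P : Fin n → A → Bool) c X → (∀ {x} → x ∈ X → c ≤ # (λ u → P u x)) →
    ∃[ u ] c * length X ≤ n * length (filterᵇ (P u) X)
  popular {n = n@(suc _)} P c X many = proj₁ best , ≤-trans (total X many) (proj₂ best)
    where
    best = sum≤max (λ u → length (filterᵇ (P u) X))
    total : ∀ X → (∀ {x} → x ∈ X → c ≤ # (λ u → P u x)) → c * length X ≤ sum (λ u → length (filterᵇ (P u) X))
    total []      _    = ≤-trans (≤-reflexive (*-zeroʳ c)) z≤n
    total (x ∷ X) many = begin
      c * suc (length X)                                       ≡⟨ *-suc c (length X) ⟩
      c + c * length X
        ≤⟨ +-mono-≤ (many (here refl)) (total X (many ∘ there)) ⟩
      # (λ u → P u x) + sum (λ u → length (filterᵇ (P u) X))   ≡⟨ cong (_+ _) #-def ⟩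
      sum (λ u → 𝟙 (P u x)) + sum (λ u → length (filterᵇ (P u) X))
        ≡⟨ ∑-distrib-+ (λ u → 𝟙 (P u x)) (λ u → length (filterᵇ (P u) X)) ⟨
      sum (λ u → 𝟙 (P u x) + length (filterᵇ (P u) X))
        ≡⟨ sum-cong-≗ (λ u → length-filterᵇ-∷ (P u) x X) ⟨
      sum (λ u → length (filterᵇ (P u) (x ∷ X)))               ∎
      where open ≤-Reasoning

  length-cartesianProductWith : ∀ {A B C : Set} (f : A → B → C) xs ys →
    length (cartesianProductWith f xs ys) ≡ length xs * length ys
  length-cartesianProductWith f []       ys = refl
  length-cartesianProductWith f (x ∷ xs) ys = begin
    length (map (f x) ys ++ cartesianProductWith f xs ys)  ≡⟨ length-++ (map (f x) ys) ⟩
    length (map (f x) ys) + _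
      ≡⟨ cong₂ _+_ (length-map (f x) ys) (length-cartesianProductWith f xs ys) ⟩
    length ys + length xs * length ys                      ∎
    where open ≡-Reasoning

  words : List A → ∀ n → List (Vec A n)
  words xs zero    = [] ∷ []
  words xs (suc n) = cartesianProductWith _∷_ xs (words xs n)

  length-words : ∀ (xs : List A) n → length (words xs n) ≡ length xs ^ n
  length-words xs zero    = refl
  length-words xs (suc n) =
    trans (length-cartesianProductWith _∷_ xs (words xs n)) (cong (length xs *_) (length-words xs n))

  ∈-words : ∀ {xs : List A} → (∀ x → x ∈ xs) → ∀ {n} (w : Vec A n) → w ∈ words xs n
  ∈-words all []      = here refl
  ∈-words all (x ∷ w) = ∈-cartesianProductWith⁺ _∷_ (all x) (∈-words all w)

  -- Greedy construction of the expander.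

  Edges : ℕ → Set
  Edges n = List (Fin n × Fin n)

  -- A loop counts twice at its vertex, so the handshake identity `sum-deg` is exact even for the
  -- loops that the greedy choice may add.
  deg : ∀ {n} → Edges n → Fin n → ℕ
  deg []            u = 0
  deg ((a , b) ∷ L) u = (𝟙 (a ≟ᵇ u) + 𝟙 (b ≟ᵇ u)) + deg L u

  sum-deg : ∀ {n} (L : Edges n) → sum (deg L) ≡ 2 * length L
  sum-deg {n} []            = trans (sum-const n) (*-zeroʳ n)
  sum-deg     ((a , b) ∷ L) = begin
    sum (λ u → (𝟙 (a ≟ᵇ u) + 𝟙 (b ≟ᵇ u)) + deg L u)
      ≡⟨ ∑-distrib-+ (λ u → 𝟙 (a ≟ᵇ u) + 𝟙 (b ≟ᵇ u)) (deg L) ⟩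
    sum (λ u → 𝟙 (a ≟ᵇ u) + 𝟙 (b ≟ᵇ u)) + sum (deg L)
      ≡⟨ cong₂ _+_ (∑-distrib-+ (λ u → 𝟙 (a ≟ᵇ u)) (λ u → 𝟙 (b ≟ᵇ u))) (sum-deg L) ⟩
    (sum (λ u → 𝟙 (a ≟ᵇ u)) + sum (λ u → 𝟙 (b ≟ᵇ u))) + 2 * length L
      ≡⟨ cong (_+ 2 * length L) (cong₂ _+_ #-def #-def) ⟨
    (# (a ≟ᵇ_) + # (b ≟ᵇ_)) + 2 * length L
      ≡⟨ cong (_+ 2 * length L) (cong₂ _+_ (#-point a) (#-point b)) ⟩
    2 + 2 * length L                                  ≡⟨ *-suc 2 (length L) ⟨
    2 * suc (length L)                                ∎
    where open ≡-Reasoning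

  module Greedy (n s d : ℕ) where

    -- The two sets may overlap, which makes the pairs the words over a four-letter alphabet. An
    -- overlapping pair may end up joined by a loop; this is harmless, since `Expanding` asks about
    -- disjoint sets.
    Pair : Set
    Pair = Vec (Bool × Bool) n

    left right : Pair → Fin n → Bool
    left  x u = proj₁ (lookup x u)
    right x u = proj₂ (lookup x u)

    hits : Fin n × Fin n → Pair → Bool
    hits (u , v) x = left x u ∧ right x v

    Big : Pair → Set
    Big x = 2 * s ≤ # (left x) × 2 * s ≤ # (right x)

    -- The bound suc d, rather than d, allows for adding a loop at a vertex of degree d - 1.
    record Valid (X : List Pair) (L : Edges n) : Set where
      field
        big    : ∀ {x} → x ∈ X → Big x
        capped : ∀ u → deg L u ≤ suc d
        covers : ∀ x → Big x → x ∈ X ⊎ ∃[ e ] e ∈ L × T (hits e x)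

    open Valid

    free : Edges n → Fin n → Bool
    free L u = deg L u <ᵇ d

    -- Markov's inequality for degrees: each saturated vertex accounts for at least `d` of the
    -- degree sum `2 * length L`, which is at most `d * s`.
    saturated-few : .{{NonZero d}} → ∀ L → 2 * length L ≤ d * s → # (not ∘ free L) ≤ s
    saturated-few L short = *-cancelˡ-≤ d (begin
      d * # (not ∘ free L)                    ≡⟨ cong (d *_) #-def ⟩
      d * sum (𝟙 ∘ not ∘ free L)              ≡⟨ *-distribˡ-sum d (𝟙 ∘ not ∘ free L) ⟩
      sum (λ u → d * 𝟙 (not (free L u)))      ≤⟨ sum-mono sat ⟩
      sum (deg L)                             ≡⟨ sum-deg L ⟩
      2 * length L                            ≤⟨ short ⟩
      d * s                                   ∎)
      where
      open ≤-Reasoning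
      sat : ∀ u → d * 𝟙 (not (free L u)) ≤ deg L u
      sat u with free L u in eq
      ... | true  = ≤-trans (≤-reflexive (*-zeroʳ d)) z≤n
      ... | false = ≤-trans (≤-reflexive (*-identityʳ d)) (≮⇒≥ (λ lt → subst T eq (<⇒<ᵇ lt)))

    -- At most `s` of the `2 * s` vertices are lost to saturation; hence the factor 2 in `Big`.
    free-many : .{{NonZero d}} → ∀ L → 2 * length L ≤ d * s → (p : Fin n → Bool) → 2 * s ≤ # p →
      s ≤ # (λ u → free L u ∧ p u)
    free-many L short p 2s≤p = +-cancelʳ-≤ s s _ (begin
      s + s                                            ≡⟨ cong (s +_) (sym (+-identityʳ s)) ⟩
      2 * s                                            ≤⟨ 2s≤p ⟩
      # p                                              ≤⟨ #-∨ split ⟩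
      # (λ u → free L u ∧ p u) + # (not ∘ free L)      ≤⟨ +-monoʳ-≤ _ (saturated-few L short) ⟩
      # (λ u → free L u ∧ p u) + s                     ∎)
      where
      open ≤-Reasoning
      split : ∀ u → T (p u) → T (free L u ∧ p u) ⊎ T (not (free L u))
      split u pu with free L u
      ... | true  = inj₁ pu
      ... | false = inj₂ tt

    capped-∷ : ∀ {L u v} → T (free L u) → T (free L v) → (∀ w → deg L w ≤ suc d) →
      ∀ w → deg ((u , v) ∷ L) w ≤ suc d
    capped-∷ {L} {u} {v} fu fv cap w with u ≟ w | v ≟ w
    ... | yes refl | yes _    = s≤s (<ᵇ⇒< _ d fu)
    ... | yes refl | no _     = s≤s (<⇒≤ (<ᵇ⇒< _ d fu))
    ... | no _     | yes refl = s≤s (<⇒≤ (<ᵇ⇒< _ d fv))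
    ... | no _     | no _     = cap w

    ∈-filterᵇ⁻ : ∀ (p : Pair → Bool) X {x} → x ∈ filterᵇ p X → x ∈ X × T (p x)
    ∈-filterᵇ⁻ p X = ∈-filter⁻ (T? ∘ p) {xs = X}

    extend : ∀ {X L u v} → Valid X L → T (free L u) → T (free L v) →
      Valid (filterᵇ (not ∘ hits (u , v)) X) ((u , v) ∷ L)
    extend {X} {L} {u} {v} valid fu fv = record
      { big    = λ x∈ → big valid (proj₁ (∈-filterᵇ⁻ (not ∘ hits (u , v)) X x∈))
      ; capped = capped-∷ {L} fu fv (capped valid)
      ; covers = cover
      }
      where
      cover : ∀ x → Big x → x ∈ filterᵇ (not ∘ hits (u , v)) X ⊎ ∃[ e ] e ∈ (u , v) ∷ L × T (hits e x)
      cover x x-big with covers valid x x-big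
      ... | inj₂ (e , e∈L , h) = inj₂ (e , there e∈L , h)
      ... | inj₁ x∈X with T? (hits (u , v) x)
      ...   | yes h = inj₂ ((u , v) , here refl , h)
      ...   | no ¬h = inj₁ (∈-filter⁺ (T? ∘ not ∘ hits (u , v)) x∈X (T-not ¬h))

    module _ (a : ℕ) .{{_ : NonZero a}} (n≡as : n ≡ a * s)
      .{{_ : NonZero n}} .{{_ : NonZero s}} .{{_ : NonZero d}} where

      -- Each pair has at least `s` suitable free vertices among all `a * s` vertices, so by
      -- `popular` some vertex suits a fraction `1 / a` of the pairs.
      popular-free : ∀ {L} → 2 * length L ≤ d * s → (p : Pair → Fin n → Bool) → ∀ X →
        (∀ {x} → x ∈ X → 2 * s ≤ # (p x)) →
        ∃[ u ] length X ≤ a * length (filterᵇ (λ x → free L u ∧ p x u) X)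
      popular-free {L} short p X p-big
        with u , most ← popular (λ u x → free L u ∧ p x u) s X (λ {x} x∈ → free-many L short (p x) (p-big x∈))
        = u , *-cancelˡ-≤ s (≤-trans most (≤-reflexive
            (trans (cong (_* ℓ u) n≡as) (trans (cong (_* ℓ u) (*-comm a s)) (*-assoc s a (ℓ u))))))
        where
        ℓ : Fin n → ℕ
        ℓ u = length (filterᵇ (λ x → free L u ∧ p x u) X)

      nonempty : ∀ (X : List Pair) → 0 < length X → ∃[ x ] x ∈ X
      nonempty (x ∷ X) _ = x , here refl

      -- The edge is chosen one end at a time: `u` suits a fraction `1 / a` of the left sets, and
      -- `v` suits a fraction `1 / a` of the right sets of the pairs that `u` suits. So `(u , v)`
      -- joins a fraction `1 / (a * a)` of `X`, and these pairs leave the list. If `X` is empty, no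
      -- edge is added.
      step : ∀ {X L} → Valid X L → 2 * length L ≤ d * s →
        ∃[ X′ ] ∃[ L′ ] Valid X′ L′ × length L′ ≤ suc (length L) ×
          a * a * length X′ + length X ≤ a * a * length X
      step {[]}    {L} valid short = [] , L , valid , n≤1+n _ , ≤-reflexive (+-identityʳ _)
      step {X@(_ ∷ _)} {L} valid short
        with u , |X|≤  ← popular-free {L} short left X (λ x∈ → proj₁ (big valid x∈))
        with v , |X₁|≤ ← popular-free {L} short right (filterᵇ (λ x → free L u ∧ left x u) X)
               (λ x∈ → proj₂ (big valid (proj₁ (∈-filterᵇ⁻ (λ x → free L u ∧ left x u) X x∈))))
        = filterᵇ (not ∘ hits (u , v)) X , (u , v) ∷ L ,
          extend valid (proj₁ (T-split (proj₂ x∈₁))) (proj₁ (T-split (proj₂ x∈₂))) , ≤-refl , (begin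
            a * a * length X′ + length X
              ≤⟨ +-monoʳ-≤ (a * a * length X′) |X|≤aa|H| ⟩
            a * a * length X′ + a * a * length H
              ≡⟨ *-distribˡ-+ (a * a) (length X′) (length H) ⟨
            a * a * (length X′ + length H)
              ≡⟨ cong (a * a *_) (trans (+-comm (length X′) (length H)) (length-filterᵇ-not (hits (u , v)) X)) ⟩
            a * a * length X                                 ∎)
        where
        open ≤-Reasoning
        p q : Pair → Bool
        p x = free L u ∧ left x u
        q x = free L v ∧ right x v
        X₁ = filterᵇ p X
        X₂ = filterᵇ q X₁
        X′ = filterᵇ (not ∘ hits (u , v)) X
        H = filterᵇ (hits (u , v)) X
        |X|≤aa|X₂| : length X ≤ a * a * length X₂
        |X|≤aa|X₂| = ≤-trans |X|≤ (≤-trans (*-monoʳ-≤ a |X₁|≤) (≤-reflexive (sym (*-assoc a a (length X₂)))))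
        hit : ∀ x → T (p x ∧ q x) → T (hits (u , v) x)
        hit x h = T-pair (proj₂ (T-split {free L u} (proj₁ (T-split {p x} h))))
                         (proj₂ (T-split {free L v} (proj₂ (T-split {p x} h))))
        |X|≤aa|H| : length X ≤ a * a * length H
        |X|≤aa|H| = ≤-trans |X|≤aa|X₂| (*-monoʳ-≤ (a * a) (≤-trans (≤-reflexive (length-filterᵇ-∧ p q X))
          (length-filterᵇ-mono hit X)))
        -- Freeness of `u` and `v` is part of the predicates `p` and `q`, so it is read off from any
        -- pair that passes both filters. Such a pair exists because `X` is nonempty.
        X₂-nonempty : 0 < length X₂
        X₂-nonempty = n≢0⇒n>0 (λ eq → 1+n≰n (≤-trans (s≤s z≤n) (≤-trans |X|≤aa|X₂|
          (≤-reflexive (trans (cong (a * a *_) eq) (*-zeroʳ (a * a)))))))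
        x∈₂ = ∈-filterᵇ⁻ q X₁ (proj₂ (nonempty X₂ X₂-nonempty))
        x∈₁ = ∈-filterᵇ⁻ p X (proj₁ x∈₂)

      -- Each step removes a fraction 1 / K of X, where K = a²; since
      -- (1 - 1/K)(K + j + 1) ≤ K + j, after j steps at most K / (K + j) of X is left.
      run : ∀ j {X L} → Valid X L → 2 * (length L + j) ≤ d * s →
        ∃[ X′ ] ∃[ L′ ] Valid X′ L′ × length L′ ≤ length L + j ×
          length X′ * (a * a + j) ≤ length X * (a * a)
      run zero    {X} {L} valid short =
        X , L , valid , m≤m+n _ 0 , ≤-reflexive (cong (length X *_) (+-identityʳ (a * a)))
      run (suc j) {X} {L} valid short
        with Y , M , valid₁ , |M| , |Y| ← run j valid
               (≤-trans (*-monoʳ-≤ 2 (+-monoʳ-≤ (length L) (n≤1+n j))) short)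
        with Z , N , valid₂ , |N| , |Z| ← step valid₁
               (≤-trans (*-monoʳ-≤ 2 (≤-trans |M| (+-monoʳ-≤ (length L) (n≤1+n j)))) short)
        = Z , N , valid₂ , ≤-trans |N| (≤-trans (s≤s |M|) (≤-reflexive (sym (+-suc (length L) j)))) ,
          ≤-trans (shrink (a * a) {{m*n≢0 a a}} j (length Z) (length Y) |Z|) |Y|
        where
        shrink : ∀ K .{{_ : NonZero K}} j z y → K * z + y ≤ K * y → z * (K + suc j) ≤ y * (K + j)
        shrink K@(suc k) j z y h = *-cancelˡ-≤ K (begin
          K * (z * (K + suc j))        ≡⟨ *-assoc K z (K + suc j) ⟨
          K * z * (K + suc j)
            ≤⟨ *-monoˡ-≤ (K + suc j) (+-cancelʳ-≤ y (K * z) (k * y) (≤-trans h (≤-reflexive (+-comm y (k * y))))) ⟩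
          k * y * (K + suc j)          ≤⟨ m≤m+n _ (y * suc j) ⟩
          k * y * (K + suc j) + y * suc j
            ≡⟨ solve 3 (λ k y j → k :* y :* ((con 1 :+ k) :+ (con 1 :+ j)) :+ y :* (con 1 :+ j)
                               := (con 1 :+ k) :* (y :* ((con 1 :+ k) :+ j))) refl k y j ⟩
          K * (y * (K + j))            ∎)
          where
          open ≤-Reasoning
          open +-*-Solver

      -- With `K = a * a` and `j = K`, `run` leaves at most `K / (K + K)` of the list, so each
      -- halving costs at most `a * a` edges.
      halvings : ∀ h {X L} → Valid X L → 2 * (length L + h * (a * a)) ≤ d * s →
        ∃[ X′ ] ∃[ L′ ] Valid X′ L′ × length X′ * 2 ^ h ≤ length X
      halvings zero    {X} {L} valid short = X , L , valid , ≤-reflexive (*-identityʳ (length X))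
      halvings (suc h) {X} {L} valid short
        with Y , M , valid₁ , |M| , |Y| ← run (a * a) valid
               (≤-trans (*-monoʳ-≤ 2 (+-monoʳ-≤ (length L) (m≤m+n (a * a) (h * (a * a))))) short)
        with Z , N , valid₂ , |Z| ← halvings h valid₁ (≤-trans (*-monoʳ-≤ 2 (≤-trans (+-monoˡ-≤ (h * (a * a)) |M|)
               (≤-reflexive (+-assoc (length L) (a * a) (h * (a * a)))))) short)
        = Z , N , valid₂ , (begin
            length Z * (2 * 2 ^ h)
              ≡⟨ solve 2 (λ z t → z :* (con 2 :* t) := con 2 :* (z :* t)) refl (length Z) (2 ^ h) ⟩
            2 * (length Z * 2 ^ h)    ≤⟨ *-monoʳ-≤ 2 |Z| ⟩
            2 * length Y
              ≤⟨ *-cancelˡ-≤ (a * a) {{m*n≢0 a a}} (≤-trans (≤-reflexive (double (a * a) (length Y)))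
                   (≤-trans |Y| (≤-reflexive (*-comm (length X) (a * a))))) ⟩
            length X                  ∎)
        where
        open ≤-Reasoning
        open +-*-Solver
        double : ∀ K y → K * (2 * y) ≡ y * (K + K)
        double = solve 2 (λ K y → K :* (con 2 :* y) := y :* (K :+ K)) refl

  allPairs : ∀ n → List (Vec (Bool × Bool) n)
  allPairs = words ((true , true) ∷ (true , false) ∷ (false , true) ∷ (false , false) ∷ [])

  ∈-allPairs : ∀ {n} (x : Vec (Bool × Bool) n) → x ∈ allPairs n
  ∈-allPairs = ∈-words λ where
    (true  , true)  → here refl
    (true  , false) → there (here refl)
    (false , true)  → there (there (here refl))
    (false , false) → there (there (there (here refl)))

  -- The degree `d` that pays for `1 + 2 * n` halvings of `a * a` edges each: with `n = a * s` and
  -- `1 ≤ s`, twice that number of edges is at most `d * s`. It depends on `a` but not on `s`.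
  expander-cap : ℕ → ℕ
  expander-cap a = 2 * (a * a * suc (2 * a))

  -- There are `4 ^ n = 2 ^ (2 * n)` pairs in all, so `1 + 2 * n` halvings leave less than one of
  -- the big pairs. By `covers`, every big pair is then joined by an edge of the list.
  expander : ∀ a .{{_ : NonZero a}} s .{{_ : NonZero s}} → Σ[ L ∈ Edges (a * s) ]
    (∀ u → deg L u ≤ suc (expander-cap a)) ×
    (∀ p q → 2 * s ≤ # p → 2 * s ≤ # q → ∃[ e ] e ∈ L × T (p (proj₁ e)) × T (q (proj₂ e)))
  expander a s = finish (halvings a refl (suc (2 * n)) initial short)
    where
    n = a * s
    d = expander-cap a
    open Greedy n s d
    open Valid
    instance
      d≢0 : NonZero d
      d≢0 = m*n≢0 2 (a * a * suc (2 * a)) {{_}} {{m*n≢0 (a * a) (suc (2 * a)) {{m*n≢0 a a}}}}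
      n≢0 : NonZero n
      n≢0 = m*n≢0 a s

    big? : ∀ x → Dec (Big x)
    big? x = (2 * s ≤? # (left x)) ×-dec (2 * s ≤? # (right x))

    initial : Valid (filter big? (allPairs n)) []
    initial = record
      { big    = λ x∈ → proj₂ (∈-filter⁻ big? {xs = allPairs n} x∈)
      ; capped = λ u → z≤n
      ; covers = λ x x-big → inj₁ (∈-filter⁺ big? (∈-allPairs x) x-big)
      }

    short : 2 * (suc (2 * n) * (a * a)) ≤ d * s
    short = begin
      2 * (suc (2 * n) * (a * a))
        ≤⟨ *-monoʳ-≤ 2 (*-monoˡ-≤ (a * a) (+-monoˡ-≤ (2 * n) (>-nonZero⁻¹ s))) ⟩
      2 * ((s + 2 * n) * (a * a))
        ≡⟨ solve 2 (λ a s → con 2 :* ((s :+ con 2 :* (a :* s)) :* (a :* a))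
                         := con 2 :* (a :* a :* (con 1 :+ con 2 :* a)) :* s) refl a s ⟩
      d * s                                        ∎
      where
      open ≤-Reasoning
      open +-*-Solver

    empty : ∀ {X} → length X * 2 ^ suc (2 * n) ≤ length (filter big? (allPairs n)) → length X < 1
    empty {X} few = *-cancelʳ-< (2 ^ suc (2 * n)) (length X) 1 (begin-strict
      length X * 2 ^ suc (2 * n)                ≤⟨ few ⟩
      length (filter big? (allPairs n))         ≤⟨ length-filter big? (allPairs n) ⟩
      length (allPairs n)                       ≡⟨ length-words _ n ⟩
      4 ^ n                                     ≡⟨ ^-*-assoc 2 2 n ⟩
      2 ^ (2 * n)                               <⟨ ^-monoʳ-< 2 (s≤s (s≤s z≤n)) (n<1+n (2 * n)) ⟩
      2 ^ suc (2 * n)                           ≡⟨ *-identityˡ _ ⟨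
      1 * 2 ^ suc (2 * n)                       ∎)
      where open ≤-Reasoning

    joined : ∀ {X L} → Valid X L → length X * 2 ^ suc (2 * n) ≤ length (filter big? (allPairs n)) →
      ∀ p q → 2 * s ≤ # p → 2 * s ≤ # q → ∃[ e ] e ∈ L × T (p (proj₁ e)) × T (q (proj₂ e))
    joined {X} {L} valid few p q p-big q-big = conclude X (empty {X} few) (covers valid x x-big)
      where
      x : Pair
      x = tabulate (λ u → p u , q u)
      left≡ : ∀ u → left x u ≡ p u
      left≡ u = cong proj₁ (lookup∘tabulate (λ u → p u , q u) u)
      right≡ : ∀ u → right x u ≡ q u
      right≡ u = cong proj₂ (lookup∘tabulate (λ u → p u , q u) u)
      x-big : Big x
      x-big = ≤-trans p-big (#-mono (λ u → subst T (sym (left≡ u)))) ,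
              ≤-trans q-big (#-mono (λ u → subst T (sym (right≡ u))))
      conclude : ∀ X → length X < 1 → x ∈ X ⊎ ∃[ e ] e ∈ L × T (hits e x) →
        ∃[ e ] e ∈ L × T (p (proj₁ e)) × T (q (proj₂ e))
      conclude []      _        (inj₁ ())
      conclude (_ ∷ _) (s≤s ()) _
      conclude []      _        (inj₂ ((u , v) , e∈L , h)) with lu , rv ← T-split {left x u} h
        = (u , v) , e∈L , subst T (left≡ u) lu , subst T (right≡ v) rv

    finish : ∃[ X ] ∃[ L ] Valid X L × length X * 2 ^ suc (2 * n) ≤ length (filter big? (allPairs n)) → _
    finish (X , L , valid , few) = L , capped valid , joined valid few

  -- Balls and growth in graphs of bounded degree.

  some : ∀ {n} → (Fin n → Bool) → Bool
  some p = isYes (any? (T? ∘ p))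

  some⁺ : ∀ {n} (p : Fin n → Bool) {i} → T (p i) → T (some p)
  some⁺ p {i} h = fromWitness {a? = any? (T? ∘ p)} (i , h)

  some⁻ : ∀ {n} (p : Fin n → Bool) → T (some p) → ∃[ i ] T (p i)
  some⁻ p h = toWitness {a? = any? (T? ∘ p)} h

  #-some : ∀ {m n} (R : Fin m → Fin n → Bool) → # (λ v → some (λ u → R u v)) ≤ sum (λ u → # (R u))
  #-some {zero}  {n} R = ≤-trans (#-mono {q = λ _ → false} none) (≤-reflexive (#-false n))
    where
    none : ∀ v → T (some (λ u → R u v)) → T false
    none v h with some⁻ (λ u → R u v) h
    ... | () , _
  #-some {suc m} R = ≤-trans (#-∨ split) (+-monoʳ-≤ (# (R zero)) (#-some (R ∘ suc)))
    where
    split : ∀ v → T (some (λ u → R u v)) → T (R zero v) ⊎ T (some (λ u → R (suc u) v))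
    split v h with some⁻ (λ u → R u v) h
    ... | zero  , r = inj₁ r
    ... | suc u , r = inj₂ (some⁺ (λ u → R (suc u) v) {u} r)

  #-∧ˡ : ∀ {n} c (p : Fin n → Bool) {K} → # p ≤ K → # (λ v → c ∧ p v) ≤ 𝟙 c * K
  #-∧ˡ true  p {K} h = ≤-trans h (≤-reflexive (sym (*-identityˡ K)))
  #-∧ˡ {n} false p h = ≤-reflexive (#-false n)

  #-some-∧ : ∀ {m n} (c : Fin m → Bool) (R : Fin m → Fin n → Bool) {K} → (∀ u → # (R u) ≤ K) →
    # (λ v → some (λ u → c u ∧ R u v)) ≤ # c * K
  #-some-∧ c R {K} R≤ = begin
    # (λ v → some (λ u → c u ∧ R u v))       ≤⟨ #-some (λ u v → c u ∧ R u v) ⟩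
    sum (λ u → # (λ v → c u ∧ R u v))        ≤⟨ sum-mono (λ u → #-∧ˡ (c u) (R u) (R≤ u)) ⟩
    sum (λ u → 𝟙 (c u) * K)                  ≡⟨ *-distribʳ-sum K (𝟙 ∘ c) ⟨
    sum (𝟙 ∘ c) * K                          ≡⟨ cong (_* K) #-def ⟨
    # c * K                                  ∎
    where open ≤-Reasoning

  opaque
    unfolding #

    ∣∣≡# : ∀ {n} (p : Subset n) → ∣ p ∣ ≡ # (lookup p)
    ∣∣≡# []            = refl
    ∣∣≡# (inside ∷ p)  = cong suc (∣∣≡# p)
    ∣∣≡# (outside ∷ p) = ∣∣≡# p

  ∈⇒T : ∀ {n} {p : Subset n} {i} → i ∈ₛ p → T (lookup p i)
  ∈⇒T i∈p = subst T (sym ([]=⇒lookup i∈p)) tt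

  T⇒∈ : ∀ {n} {p : Subset n} {i} → T (lookup p i) → i ∈ₛ p
  T⇒∈ {p = p} {i} h with lookup p i in eq
  ... | true = lookup⇒[]= i p eq

  module _ (G : Graph) where
    open Graph G

    ball : ℕ → Vertex → Vertex → Bool
    ball zero    x v = x ≟ᵇ v
    ball (suc r) x v = (x ≟ᵇ v) ∨ some (λ u → adj x u ∧ ball r u v)

    -- Strictness of the degree bound makes room for the centre: `1 + deg * b ^ r ≤ (1 + deg) * b ^
    -- r ≤ b * b ^ r`.
    #-ball : ∀ {b} → (∀ u → # (adj u) < b) → ∀ r x → # (ball r x) ≤ b ^ r
    #-ball     deg< zero    x = ≤-reflexive (#-point x)
    #-ball {b} deg< (suc r) x = begin
      # (ball (suc r) x)                                          ≤⟨ #-∨ (λ v → T-case {x ≟ᵇ v}) ⟩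
      # (x ≟ᵇ_) + # (λ v → some (λ u → adj x u ∧ ball r u v))
        ≤⟨ +-mono-≤ (≤-reflexive (#-point x)) (#-some-∧ (adj x) (ball r) (#-ball deg< r)) ⟩
      1 + # (adj x) * b ^ r
        ≤⟨ +-monoˡ-≤ (# (adj x) * b ^ r) (m^n>0 b {{>-nonZero (≤-<-trans z≤n (deg< x))}} r) ⟩
      suc (# (adj x)) * b ^ r                                     ≤⟨ *-monoˡ-≤ (b ^ r) (deg< x) ⟩
      b * b ^ r                                                   ∎
      where open ≤-Reasoning

    walk⇒ball : {_⟶_ : Vertex → Vertex → Set} → (∀ {u v} → u ⟶ v → u ~ v) →
      ∀ {k r x v} → k ≤ r → Walk _⟶_ x v k → T (ball r x v)
    walk⇒ball ⟶⇒~ {r = zero}  {x} _ []  = ≟ᵇ-refl x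
    walk⇒ball ⟶⇒~ {r = suc r} {x} _ []  = T-inj₁ (≟ᵇ-refl x)
    walk⇒ball ⟶⇒~ {r = suc r} {x} {v} (s≤s k≤r) (_∷_ {y = y} e w) =
      T-inj₂ {x ≟ᵇ v} (some⁺ (λ u → adj x u ∧ ball r u v) {y} (T-pair (⟶⇒~ e) (walk⇒ball ⟶⇒~ k≤r w)))

    growth≤order : (H : Subgraph G) → ∣ Subgraph.vertices H ∣ ≤ order
    growth≤order H = ≤-trans (≤-reflexive (∣∣≡# vertices)) (#≤n (lookup vertices))
      where open Subgraph H

    growth≤^ : ∀ {b} → (∀ u → # (adj u) < b) → ∀ {r} (H : Subgraph G) → RadiusAtMost H r →
      ∣ Subgraph.vertices H ∣ ≤ b ^ r
    growth≤^ deg< {r} H (x , _ , walks) = ≤-trans (≤-reflexive (∣∣≡# vertices)) (≤-trans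
      (#-mono (λ u u∈ → let k , k≤r , w = walks u (T⇒∈ u∈) in walk⇒ball (λ {u} {v} → edge⇒adj u v) k≤r w))
      (#-ball deg< r x))
      where open Subgraph H

  -- From edge lists to simple graphs.

  module _ {n : ℕ} where

    joins : Edges n → Fin n → Fin n → Bool
    joins []            u v = false
    joins ((a , b) ∷ L) u v = ((a ≟ᵇ u) ∧ (b ≟ᵇ v) ∨ (b ≟ᵇ u) ∧ (a ≟ᵇ v)) ∨ joins L u v

    joins-sym : ∀ L u v → joins L u v ≡ joins L v u
    joins-sym []            u v = refl
    joins-sym ((a , b) ∷ L) u v = cong₂ _∨_
      (trans (∨-comm ((a ≟ᵇ u) ∧ (b ≟ᵇ v)) _) (cong₂ _∨_ (∧-comm (b ≟ᵇ u) _) (∧-comm (a ≟ᵇ u) _)))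
      (joins-sym L u v)

    joins-∈ : ∀ {L u v} → (u , v) ∈ L → T (joins L u v)
    joins-∈ {(u , v) ∷ L} (here refl) =
      T-inj₁ {b = joins L u v} (T-inj₁ {b = (v ≟ᵇ u) ∧ (u ≟ᵇ v)} (T-pair (≟ᵇ-refl u) (≟ᵇ-refl v)))
    joins-∈ {(a , b) ∷ L} {u} {v} (there e∈L) = T-inj₂ {(a ≟ᵇ u) ∧ (b ≟ᵇ v) ∨ (b ≟ᵇ u) ∧ (a ≟ᵇ v)} (joins-∈ e∈L)

    #-joins : ∀ L u → # (joins L u) ≤ deg L u
    #-joins []            u = ≤-reflexive (#-false n)
    #-joins ((a , b) ∷ L) u = ≤-trans (#-∨ (λ v → T-case)) (+-mono-≤
      (≤-trans (#-∨ (λ v → T-case)) (+-mono-≤ (one (a ≟ᵇ u) b) (one (b ≟ᵇ u) a)))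
      (#-joins L u))
      where
      one : ∀ c x → # (λ v → c ∧ (x ≟ᵇ v)) ≤ 𝟙 c
      one c x = ≤-trans (#-∧ˡ c (x ≟ᵇ_) (≤-reflexive (#-point x))) (≤-reflexive (*-identityʳ (𝟙 c)))

    ≟ᵇ-sym : ∀ (u v : Fin n) → (u ≟ᵇ v) ≡ (v ≟ᵇ u)
    ≟ᵇ-sym u v with u ≟ v | v ≟ u
    ... | yes _   | yes _   = refl
    ... | no _    | no _    = refl
    ... | yes u≡v | no v≢u  = contradiction (sym u≡v) v≢u
    ... | no u≢v  | yes v≡u = contradiction (sym v≡u) u≢v

    -- Loops are dropped and repeated entries merge. Neither raises a degree, and an edge between
    -- disjoint sets is never a loop.
    graph : Edges n → Graph
    graph L = record
      { order      = n
      ; adj        = λ u v → not (u ≟ᵇ v) ∧ joins L u v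
      ; adj-sym    = λ u v → cong₂ (λ e j → not e ∧ j) (≟ᵇ-sym u v) (joins-sym L u v)
      ; adj-irrefl = λ v → irrefl v (joins L v v)
      }
      where
      irrefl : ∀ v b → not (v ≟ᵇ v) ∧ b ≡ false
      irrefl v b with v ≟ v
      ... | yes _  = refl
      ... | no v≢v = contradiction refl v≢v

    graph-deg : ∀ L u → # (Graph.adj (graph L) u) ≤ deg L u
    graph-deg L u = ≤-trans (#-mono (λ v h → proj₂ (T-split {not (u ≟ᵇ v)} h))) (#-joins L u)

    graph-∈ : ∀ {L u v} → (u , v) ∈ L → u ≢ v → Graph._~_ (graph L) u v
    graph-∈ {L} {u} {v} e∈L u≢v = T-pair {not (u ≟ᵇ v)} (T-not (λ h → u≢v (≟ᵇ⇒≡ h))) (joins-∈ e∈L)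

  -- Search orders and simple paths in trees.

  module Tree (𝕋 : Graph) where
    open Graph 𝕋 renaming (Vertex to Node)

    ~-sym : ∀ {a b} → a ~ b → b ~ a
    ~-sym {a} {b} = subst T (adj-sym a b)

    -- The nodes in reverse order of a search: each new node has an earlier neighbour.
    data Search : List Node → Set where
      root : ∀ x → Search (x ∷ [])
      grow : ∀ {y p P} → y ∉ P → p ∈ P → p ~ y → Search P → Search (y ∷ P)

    data Path : Node → Node → List Node → Set where
      stop : ∀ {a} → Path a a (a ∷ [])
      go   : ∀ {a b c vs} → a ~ b → Path b c vs → Path a c (a ∷ vs)

    snoc : ∀ {a b c vs} → Path a b vs → b ~ c → Path a c (vs ∷ʳ c)
    snoc stop     e′ = go e′ stop
    snoc (go e p) e′ = go e (snoc p e′)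

    close : ∀ {z a b y vs} → z ~ a → Path a b vs → b ~ y → Linked _~_ (z ∷ (vs ∷ʳ y))
    close e stop      e″ = e ∷ (e″ ∷ [-])
    close e (go e′ p) e″ = e ∷ close e′ p e″

    Simple : List Node → Node → Node → Set
    Simple P a b = ∃[ vs ] Path a b vs × Unique vs × All (_∈ P) vs

    ∉⇒All≢ : ∀ {y : Node} {P vs} → y ∉ P → All (_∈ P) vs → All (y ≢_) vs
    ∉⇒All≢ y∉P = All.map (λ v∈P y≡v → y∉P (subst (_∈ _) (sym y≡v) v∈P))

    -- Induction along the search: a path from or to the newest node `y` goes through its earlier
    -- neighbour `p`, and stays simple because the rest of it lies in `P`, which does not contain
    -- `y`.
    simple : ∀ {P} → Search P → ∀ {a b} → a ∈ P → b ∈ P → Simple P a b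
    simple (root x) (here refl) (here refl) = x ∷ [] , stop , [] ∷ [] , here refl ∷ []
    simple (grow y∉P p∈P e S) (here refl) (here refl) = _ , stop , [] ∷ [] , here refl ∷ []
    simple (grow y∉P p∈P e S) (there a∈P) (there b∈P) =
      let vs , path , uniq , vs⊆P = simple S a∈P b∈P
      in  vs , path , uniq , All.map there vs⊆P
    simple (grow y∉P p∈P e S) (here refl) (there b∈P) =
      let vs , path , uniq , vs⊆P = simple S p∈P b∈P
      in  _ , go (~-sym e) path , ∉⇒All≢ y∉P vs⊆P ∷ uniq , here refl ∷ All.map there vs⊆P
    simple (grow {y} y∉P p∈P e S) (there a∈P) (here refl) =
      let vs , path , uniq , vs⊆P = simple S a∈P p∈P
      in  vs ∷ʳ y , snoc path e ,
          Unique.++⁺ uniq ([] ∷ []) (λ { (v∈vs , here refl) → y∉P (All.lookup vs⊆P v∈vs) }) ,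
          All.++⁺ (All.map there vs⊆P) (here refl ∷ [])

    -- Two distinct neighbours of `y` in `P` are linked by a simple path within `P`, which closes
    -- through `y` to a cycle. Distinctness gives the path the two nodes that `IsCycle` demands
    -- besides `y`. Hence `y` is a leaf of the tree on `y ∷ P`.
    unique-parent : (∀ v vs → ¬ IsCycle 𝕋 v vs) → ∀ {P y a b} → Search P → y ∉ P →
      a ∈ P → b ∈ P → a ~ y → b ~ y → a ≡ b
    unique-parent acyclic {P} {y} {a} {b} S y∉P a∈P b∈P a~y b~y with a ≟ b
    ... | yes a≡b = a≡b
    ... | no a≢b with vs , path , uniq , vs⊆P ← simple S a∈P b∈P =
      ⊥-elim (acyclic y vs (long path , ∉⇒All≢ y∉P vs⊆P ∷ uniq , close (~-sym a~y) path b~y))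
      where
      long : ∀ {vs} → Path a b vs → 2 ≤ length vs
      long stop              = contradiction refl a≢b
      long (go _ stop)       = s≤s (s≤s z≤n)
      long (go _ (go _ _))   = s≤s (s≤s z≤n)

    _∈?_ : ∀ (z : Node) P → Dec (z ∈ P)
    z ∈? P = List.any? (z ≟_) P

    -- Follows the walk, and whenever it steps to a new node, appends that node to the search with
    -- its predecessor on the walk as parent.
    reach : ∀ {P a z} → Search P → a ∈ P → Star _~_ a z → ∃[ Q ] Search Q × P ⊆ Q × z ∈ Q
    reach {P} S a∈P ε = P , S , id , a∈P
    reach {P} S a∈P (_◅_ {j = b} e es) with b ∈? P
    ... | yes b∈P = reach S b∈P es
    ... | no b∉P  = let Q , S′ , ⊆Q , z∈Q = reach (grow b∉P a∈P e S) (here refl) es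
                    in  Q , S′ , ⊆Q ∘ there , z∈Q

    reach-all : (∀ u v → Star _~_ u v) → ∀ {a P} → Search P → a ∈ P → ∀ zs →
      ∃[ Q ] Search Q × a ∈ Q × (∀ {z} → z ∈ zs → z ∈ Q)
    reach-all conn {P = P} S a∈P [] = P , S , a∈P , λ ()
    reach-all conn {a} S a∈P (z ∷ zs)
      with Q , S₁ , a∈Q , zs⊆Q ← reach-all conn S a∈P zs
      with R , S₂ , Q⊆R , z∈R ← reach S₁ a∈Q (conn a z)
      = R , S₂ , Q⊆R a∈Q , λ { (here refl) → z∈R ; (there z∈) → Q⊆R (zs⊆Q z∈) }

    search : IsTree 𝕋 → ∃[ P ] Search P × (∀ z → z ∈ P)
    search (1≤order , conn , _) =
      let P , S , _ , all∈P = reach-all conn (root (fromℕ< 1≤order)) (here refl) (allFin order)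
      in  P , S , λ z → all∈P (∈-allFin z)

  -- Tree-decompositions of expanding graphs have a large bag.

  Expanding : Graph → ℕ → Set
  Expanding G w = ∀ (A B : Vertex → Bool) → w ≤ # A → w ≤ # B → (∀ v → T (A v) → ¬ T (B v)) →
    ∃[ u ] ∃[ v ] T (A u) × T (B v) × u ~ v
    where open Graph G

  module Separation {G : Graph} (D : TreeDecomposition G) where
    open TreeDecomposition D
    open Graph G using (Vertex; order; _~_)
    open Tree tree

    inBag : Node → Vertex → Bool
    inBag z v = lookup (bag z) v

    fibre : (Node → Node) → Node → Vertex → Bool
    fibre π x v = some (λ z → (π z ≟ᵇ x) ∧ inBag z v)

    fibre⁺ : ∀ {π x v z} → π z ≡ x → T (inBag z v) → T (fibre π x v)
    fibre⁺ {π} {v = v} {z} refl v∈z = some⁺ (λ y → (π y ≟ᵇ π z) ∧ inBag y v) {z} (T-pair (≟ᵇ-refl (π z)) v∈z)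

    fibre⁻ : ∀ {π x v} → T (fibre π x v) → ∃[ z ] π z ≡ x × T (inBag z v)
    fibre⁻ {π} {x} {v} h with z , h′ ← some⁻ (λ y → (π y ≟ᵇ x) ∧ inBag y v) h =
      z , ≟ᵇ⇒≡ (proj₁ (T-split h′)) , proj₂ (T-split {π z ≟ᵇ x} h′)

    -- The set `U` of the outline, for the node `x` and the contraction `π`.
    below : (Node → Node) → Node → Vertex → Bool
    below π x v = fibre π x v ∧ not (inBag x v)

    below⁺ : ∀ {π x v z} → π z ≡ x → T (inBag z v) → ¬ T (inBag x v) → T (below π x v)
    below⁺ {π} {x} πz≡x v∈z v∉x = T-pair (fibre⁺ {π} {x} πz≡x v∈z) (T-not v∉x)

    below⁻ : ∀ {π x v} → T (below π x v) → (∃[ z ] π z ≡ x × T (inBag z v)) × ¬ T (inBag x v)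
    below⁻ {π} {x} {v} h = fibre⁻ (proj₁ (T-split {fibre π x v} h)) , T-not⁻ (proj₂ (T-split {fibre π x v} h))

    -- A fibre of π can be left only at a node fixed by π.
    Exits : (Node → Node) → Set
    Exits π = ∀ {a b} → a ~ᵀ b → π a ≢ π b → π a ≡ a × π b ≡ b

    -- The nodes outside P are contracted into their nearest ancestors in P.
    record Retraction (P : List Node) (w : ℕ) : Set where
      field
        π     : Node → Node
        into  : ∀ z → π z ∈ P
        fixes : ∀ {z} → z ∈ P → π z ≡ z
        exits : Exits π
        small : ∀ {x} → x ∈ P → # (below π x) < w

    open Retraction

    -- By `Exits`, the walk can leave the fibre over `x` only from `x` itself, but all bags along
    -- the walk contain `u`, and that of `x` does not.
    stays : ∀ (π : Node → Node) → Exits π → ∀ {x u} → ¬ T (inBag x u) →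
      ∀ {y z} → Star (λ a b → a ~ᵀ b × u ∈ₛ bag a × u ∈ₛ bag b) y z → π y ≡ x → π z ≡ x
    stays π exits u∉x ε πy≡x = πy≡x
    stays π exits {x} {u} u∉x (_◅_ {y} {b} (e , u∈y , _) es) πy≡x with π y ≟ π b
    ... | yes eq = stays π exits u∉x es (trans (sym eq) πy≡x)
    ... | no neq =
      contradiction (subst (λ z → T (inBag z u)) (trans (sym (proj₁ (exits e neq))) πy≡x) (∈⇒T u∈y)) u∉x

    -- Some bag contains both ends of the edge. The bags of `u` are connected and avoid `x`, so by
    -- `stays` that bag lies in the fibre over `x` too, which puts `v` there.
    separates : ∀ (π : Node → Node) → Exits π → ∀ {x u v} → u ~ v →
      T (below π x u) → ¬ T (inBag x v) → T (below π x v)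
    separates π exits {x} {u} {v} u~v below-u v∉x
      with (z , πz≡x , u∈z) , u∉x ← below⁻ {π} {x} {u} below-u
      with y , u∈y , v∈y ← edge-covered u v u~v
      = below⁺ {π} {x} (stays π exits u∉x (bags-connected u z y (T⇒∈ u∈z) u∈y) πz≡x) (∈⇒T v∈y) v∉x

    module _ {w : ℕ} (expanding : Expanding G w) (thin : ∀ x → # (inBag x) ≤ w)
      (5w≤n : 5 * w ≤ order) (0<w : 0 < w) where

      rest : (Vertex → Bool) → Node → Vertex → Bool
      rest A x v = not (A v) ∧ not (inBag x v)

      -- A gap in the possible sizes: if `U` had between `w` and `3 * w` vertices, then at least
      -- `5 * w - 3 * w - w = w` vertices would lie outside both `U` and the bag of `x`. Expansion
      -- would join them to `U`, against `separates`.
      no-balanced : ∀ (π : Node → Node) → Exits π → ∀ {x} →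
        # (below π x) ≤ 3 * w → # (below π x) < w
      no-balanced π exits {x} U≤3w with # (below π x) <? w
      ... | yes U<w = U<w
      ... | no U≮w = ⊥-elim
        (let u , v , Uu , Wv , u~v = expanding U W (≮⇒≥ U≮w) w≤W disjoint
             ¬Uv , v∉x = T-split {not (U v)} Wv
         in T-not⁻ ¬Uv (separates π exits u~v Uu (T-not⁻ v∉x)))
        where
        U = below π x
        W = rest U x
        disjoint : ∀ v → T (U v) → ¬ T (W v)
        disjoint v Uv Wv = T-not⁻ (proj₁ (T-split {not (U v)} Wv)) Uv
        trichotomy : ∀ a b → T (a ∨ (b ∨ not a ∧ not b))
        trichotomy true  _     = tt
        trichotomy false true  = tt
        trichotomy false false = tt
        cover : ∀ v → T (U v ∨ (inBag x v ∨ W v))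
        cover v = trichotomy (U v) (inBag x v)
        w≤W : w ≤ # W
        w≤W = +-cancelˡ-≤ (4 * w) w (# W) (begin
          4 * w + w                        ≡⟨ +-comm (4 * w) w ⟩
          5 * w                            ≤⟨ 5w≤n ⟩
          order                            ≤⟨ #-all cover ⟩
          # (λ v → U v ∨ (inBag x v ∨ W v)) ≤⟨ #-∨ (λ v → T-case {U v}) ⟩
          # U + # (λ v → inBag x v ∨ W v)
            ≤⟨ +-mono-≤ U≤3w (≤-trans (#-∨ (λ v → T-case {inBag x v})) (+-monoˡ-≤ (# W) (thin x))) ⟩
          3 * w + (w + # W)
            ≡⟨ solve 2 (λ w b → con 3 :* w :+ (w :+ b) := con 4 :* w :+ b) refl w (# W) ⟩
          4 * w + # W                      ∎)
          where
          open ≤-Reasoning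
          open +-*-Solver

      module _ {y p : Node} {P : List Node} (y∉P : y ∉ P) (p∈P : p ∈ P) (p~y : p ~ᵀ y) (S : Search P)
        (R : Retraction (y ∷ P) w) where

        merge : Node → Node
        merge z with z ≟ y
        ... | yes _ = p
        ... | no _  = z

        merge-y : merge y ≡ p
        merge-y with y ≟ y
        ... | yes _  = refl
        ... | no y≢y = contradiction refl y≢y

        merge-≢ : ∀ {z} → z ≢ y → merge z ≡ z
        merge-≢ {z} z≢y with z ≟ y
        ... | yes z≡y = contradiction z≡y z≢y
        ... | no _    = refl

        ∈P⇒≢y : ∀ {z} → z ∈ P → z ≢ y
        ∈P⇒≢y z∈P z≡y = y∉P (subst (_∈ P) z≡y z∈P)

        merge-∈ : ∀ {z} → z ∈ y ∷ P → merge z ∈ P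
        merge-∈ (here refl) = subst (_∈ P) (sym merge-y) p∈P
        merge-∈ (there z∈P) = subst (_∈ P) (sym (merge-≢ (∈P⇒≢y z∈P))) z∈P

        π′ : Node → Node
        π′ z = merge (π R z)

        -- The one new danger is an edge leaving a fibre at `y`, which `π′` no longer fixes. By
        -- `unique-parent` its other end, if fixed by `π R` and distinct from `y`, is `p`, so after
        -- the merge both ends lie in the same fibre.
        merge-exits : (∀ v vs → ¬ IsCycle tree v vs) → Exits π′
        merge-exits acyclic {a} {b} a~b π′a≢π′b with exits R a~b (π′a≢π′b ∘ cong merge)
        ... | πa≡a , πb≡b = trans (cong merge πa≡a) (merge-≢ a≢y) , trans (cong merge πb≡b) (merge-≢ b≢y)
          where
          parent : ∀ {z} → z ~ᵀ y → π R z ≡ z → π′ z ≡ p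
          parent {z} z~y πz≡z with z ≟ y | subst (_∈ y ∷ P) πz≡z (into R z)
          ... | yes refl | _         = trans (cong merge πz≡z) merge-y
          ... | no z≢y | here z≡y    = contradiction z≡y z≢y
          ... | no z≢y | there z∈P   = trans (cong merge πz≡z) (trans (merge-≢ z≢y)
            (unique-parent acyclic S y∉P z∈P p∈P z~y p~y))
          a≢y : a ≢ y
          a≢y refl = π′a≢π′b (trans (trans (cong merge πa≡a) merge-y) (sym (parent (~-sym a~b) πb≡b)))
          b≢y : b ≢ y
          b≢y refl = π′a≢π′b (trans (parent a~b πa≡a) (sym (trans (cong merge πb≡b) merge-y)))

        merge-origin : ∀ {x z} → merge z ≡ x → z ≡ x ⊎ (z ≡ y × x ≡ p)
        merge-origin {x} {z} eq with z ≟ y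
        ... | yes z≡y = inj₂ (z≡y , sym eq)
        ... | no _    = inj₁ eq

        below-other : ∀ {x} → x ≢ p → ∀ v → T (below π′ x v) → T (below (π R) x v)
        below-other {x} x≢p v h with (z , π′z≡x , v∈z) , v∉x ← below⁻ {π′} {x} {v} h
                                with merge-origin π′z≡x
        ... | inj₁ πz≡x      = below⁺ {π R} {x} πz≡x v∈z v∉x
        ... | inj₂ (_ , x≡p) = contradiction x≡p x≢p

        below-p : ∀ v → T (below π′ p v) → T (below (π R) p v) ⊎ T (below (π R) y v ∨ inBag y v)
        below-p v h with (z , π′z≡p , v∈z) , v∉p ← below⁻ {π′} {p} {v} h
                    with merge-origin π′z≡p
        ... | inj₁ πz≡p = inj₁ (below⁺ {π R} {p} πz≡p v∈z v∉p)
        ... | inj₂ (πz≡y , _) with T? (inBag y v)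
        ...   | yes v∈y = inj₂ (T-inj₂ {below (π R) y v} v∈y)
        ...   | no v∉y  = inj₂ (T-inj₁ {below (π R) y v} (below⁺ {π R} {y} πz≡y v∈z v∉y))

        -- Only the set at `p` grows. By `below-p` it is covered by the old sets at `p` and `y` and
        -- the bag of `y`, each of at most `w` vertices, so it has at most `3 * w`; `no-balanced`
        -- then brings it back below `w`.
        merge-small : (∀ v vs → ¬ IsCycle tree v vs) → ∀ {x} → x ∈ P → # (below π′ x) < w
        merge-small acyclic {x} x∈P with x ≟ p
        ... | no x≢p   = ≤-<-trans (#-mono (below-other x≢p)) (small R (there x∈P))
        ... | yes refl = no-balanced π′ (merge-exits acyclic) (begin
          # (below π′ p)                                              ≤⟨ #-∨ below-p ⟩
          # (below (π R) p) + # (λ v → below (π R) y v ∨ inBag y v)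
            ≤⟨ +-mono-≤ (<⇒≤ (small R (there x∈P))) (#-∨ (λ v → T-case {below (π R) y v})) ⟩
          w + (# (below (π R) y) + # (inBag y))
            ≤⟨ +-monoʳ-≤ w (+-mono-≤ (<⇒≤ (small R (here refl))) (thin y)) ⟩
          w + (w + w)
            ≡⟨ cong (λ t → w + (w + t)) (sym (+-identityʳ w)) ⟩
          3 * w                                                       ∎)
          where open ≤-Reasoning

        merged : (∀ v vs → ¬ IsCycle tree v vs) → Retraction P w
        merged acyclic = record
          { π     = π′
          ; into  = λ z → merge-∈ (into R z)
          ; fixes = λ z∈P → trans (cong merge (fixes R (there z∈P))) (merge-≢ (∈P⇒≢y z∈P))
          ; exits = merge-exits acyclic
          ; small = merge-small acyclic
          }

      -- Undoing the search contracts a leaf at each step. At the last node everything lies in `U`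
      -- or in the bag, which together have fewer than `2 * w` vertices.
      collapse : ∀ {P} → Search P → Retraction P w → ⊥
      collapse (grow y∉P p∈P p~y S) R = collapse S (merged y∉P p∈P p~y S R (proj₂ (proj₂ isTree)))
      collapse (root x) R = <-irrefl refl (begin-strict
        5 * w                                   ≤⟨ 5w≤n ⟩
        order                                   ≤⟨ #-all cover ⟩
        # (λ v → below (π R) x v ∨ inBag x v)   ≤⟨ #-∨ (λ v → T-case {below (π R) x v}) ⟩
        # (below (π R) x) + # (inBag x)         <⟨ +-mono-<-≤ (small R (here refl)) (thin x) ⟩
        w + w                                   ≤⟨ +-monoʳ-≤ w (m≤m+n w (3 * w)) ⟩
        5 * w                                   ∎)
        where
        open ≤-Reasoning
        cover : ∀ v → T (below (π R) x v ∨ inBag x v)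
        cover v with z , v∈z ← vertex-covered v with into R z | T? (inBag x v)
        ... | here πz≡x | yes v∈x = T-inj₂ {below (π R) x v} v∈x
        ... | here πz≡x | no v∉x  = T-inj₁ (below⁺ {π R} {x} πz≡x (∈⇒T v∈z) v∉x)

      not-thin : ⊥
      not-thin with P , S , all∈P ← search isTree = collapse S record
        { π     = id
        ; into  = all∈P
        ; fixes = λ _ → refl
        ; exits = λ _ _ → refl , refl
        -- Before any contraction each fibre is a single node, so `below` is empty and `0 < w`
        -- suffices.
        ; small = λ {x} _ → ≤-<-trans (≤-trans (#-mono {q = λ _ → false} (λ v h →
            let (z , z≡x , v∈z) , v∉x = below⁻ {id} {x} {v} h in v∉x (subst (λ z → T (inBag z v)) z≡x v∈z)))
            (≤-reflexive (#-false order))) 0<w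
        }

  ≤-foldr-⊔ : ∀ {n} (f : Fin n → ℕ) i → f i ≤ Vector.foldr _⊔_ 0 f
  ≤-foldr-⊔ f zero    = m≤m⊔n (f zero) _
  ≤-foldr-⊔ f (suc i) = ≤-trans (≤-foldr-⊔ (f ∘ suc) i) (m≤n⊔m (f zero) _)

  maxBagSize-expanding : ∀ {G w} → Expanding G w → 5 * w ≤ Graph.order G → 0 < w →
    ∀ (D : TreeDecomposition G) → w < TreeDecomposition.maxBagSize D
  maxBagSize-expanding {w = w} expanding 5w≤n 0<w D = ≰⇒> λ max≤w →
    Separation.not-thin D expanding
      (λ x → ≤-trans (≤-reflexive (sym (∣∣≡# (bag x)))) (≤-trans (≤-foldr-⊔ (λ x → ∣ bag x ∣) x) max≤w))
      5w≤n 0<w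
    where open TreeDecomposition D

  -- Existence of the treewidth, and its lower bound for expanders.

  trivial : ∀ G → TreeDecomposition G
  trivial G = record
    { tree           = point
    ; isTree         = s≤s z≤n , (λ { zero zero → ε }) , acyclic
    ; bag            = λ _ → ⊤
    ; edge-covered   = λ _ _ _ → zero , ∈⊤ , ∈⊤
    ; vertex-covered = λ _ → zero , ∈⊤
    ; bags-connected = λ { _ zero zero _ _ → ε }
    }
    where
    point : Graph
    point = record { order = 1 ; adj = λ _ _ → false ; adj-sym = λ _ _ → refl ; adj-irrefl = λ _ → refl }
    acyclic : ∀ v vs → ¬ IsCycle point v vs
    acyclic v []       (() , _ , _)
    acyclic v (_ ∷ []) (s≤s () , _ , _)
    acyclic v (_ ∷ _ ∷ _) (_ , _ , () ∷ _)

  -- `Q` need not be decidable, so the least element is only not absent: if there were none, strong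
  -- induction would refute `Q` at every number.
  ¬¬-least : ∀ {Q : ℕ → Set} {n} → Q n → ¬ ¬ (∃[ m ] Q m × ∀ k → Q k → m ≤ k)
  ¬¬-least {Q} {n} q none = below (suc n) n ≤-refl q
    where
    below : ∀ n k → k < n → ¬ Q k
    below (suc n) k (s≤s k≤n) qk = none (k , qk , λ j qj → ≮⇒≥ λ j<k → below n j (<-≤-trans j<k k≤n) qj)

  ¬¬-treewidth : ∀ G → ¬ ¬ ∃ (IsTreewidth G)
  ¬¬-treewidth G none = ¬¬-least {Q = λ n → Σ[ D ∈ TreeDecomposition G ] TreeDecomposition.maxBagSize D ≡ n}
    (trivial G , refl) λ (n , (D , eq) , least) →
      none (ℤ.+ n ℤ.- ℤ.1ℤ , (D , cong (λ n → ℤ.+ n ℤ.- ℤ.1ℤ) eq) ,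
            λ D′ → ℤ.+-monoˡ-≤ (ℤ.- ℤ.1ℤ) (ℤ.+≤+ (least _ (D′ , refl))))

  -- The strict bound on the largest bag absorbs the `- 1` in the width, and shows that the width is
  -- a natural number.
  treewidth-expanding : ∀ {G w} → Expanding G w → 5 * w ≤ Graph.order G → 0 < w →
    ∀ {t} → IsTreewidth G t → ∃[ n ] t ≡ ℤ.+ n × w ≤ n
  treewidth-expanding expanding 5w≤n 0<w ((D , refl) , _)
    with TreeDecomposition.maxBagSize D | maxBagSize-expanding expanding 5w≤n 0<w D
  ... | suc n | s≤s w≤n = n , refl , w≤n

  BoundedDegreeExpanders : ℕ → Set
  BoundedDegreeExpanders b = ∀ s .{{_ : NonZero s}} → Σ[ G ∈ Graph ]
    Graph.order G ≡ 10 * s × (∀ u → # (Graph.adj G u) < b) × Expanding G (2 * s)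

  -- Taking `a = 10` makes the joined sets, of `2 * s` vertices, a fifth of all `10 * s`, as the
  -- separation argument requires. Degrees are at most `1 + expander-cap 10`, so
  -- `2 + expander-cap 10` bounds them strictly.
  bounded-degree-expanders : ∃[ b ] 2 ≤ b × BoundedDegreeExpanders b
  bounded-degree-expanders = 2 + expander-cap 10 , s≤s (s≤s z≤n) , λ s → build s (expander 10 s)
    where
    build : ∀ s → Σ[ L ∈ Edges (10 * s) ]
        (∀ u → deg L u ≤ suc (expander-cap 10)) ×
        (∀ p q → 2 * s ≤ # p → 2 * s ≤ # q → ∃[ e ] e ∈ L × T (p (proj₁ e)) × T (q (proj₂ e))) →
      Σ[ G ∈ Graph ] Graph.order G ≡ 10 * s × (∀ u → # (Graph.adj G u) < 2 + expander-cap 10) × Expanding G (2 * s)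
    build s (L , deg≤ , joined) = graph L , refl , (λ u → s≤s (≤-trans (graph-deg L u) (deg≤ u))) ,
      λ A C A-big C-big disjoint → let (u , v) , e∈L , Au , Cv = joined A C A-big C-big in
        u , v , Au , Cv , graph-∈ {L = L} e∈L (λ u≡v → disjoint u Au (subst (T ∘ C) (sym u≡v) Cv))

module Analysis where

  open Combinatorics
    using (#; Edges; deg; expander-cap; expander; graph; graph-deg; graph-∈; growth≤order; growth≤^;
           Expanding; ¬¬-treewidth; treewidth-expanding; BoundedDegreeExpanders)
  open import Data.Fin.Subset using (∣_∣)
  open import Data.Integer.Base as ℤ using (ℤ)
  open import Data.Nat.Base as ℕ using (ℕ; zero; suc; s≤s; z≤n)
  open import Data.Nat.DivMod using (m/n*n≤m; m≡m%n+[m/n]*n; m%n<n; m≥n⇒m/n>0)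
  import Data.Nat.Properties as ℕ
  open import Data.Nat.Solver using () renaming (module +-*-Solver to ℕ-Solver)
  open import Data.Product.Base using (∃-syntax; Σ-syntax; _×_; _,_; proj₁; proj₂)
  open import Data.Rational.Base as ℚ
    using (ℚ; 0ℚ; 1ℚ; ½; _+_; _*_; _-_; -_; 1/_; _⊔_; _⊓_; _≤_; _<_)
  import Data.Rational.Properties as ℚ
  open import Data.Rational.Solver using (module +-*-Solver)
  open import Data.Sum.Base using (inj₁; inj₂)
  open import Defs
  open import Relation.Binary.PropositionalEquality
  open import Relation.Nullary.Decidable using (yes; no)
  open import Relation.Nullary.Negation using (¬_; contradiction)

  -- Natural numbers among the rationals.

  fromℕℚ-+ : ∀ m n → fromℕℚ (m ℕ.+ n) ≡ fromℕℚ m + fromℕℚ n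
  fromℕℚ-+ zero    n = sym (ℚ.+-identityˡ (fromℕℚ n))
  fromℕℚ-+ (suc m) n = begin
    fromℕℚ (suc (m ℕ.+ n))         ≡⟨ fromℕℚ-suc (m ℕ.+ n) ⟩
    1ℚ + fromℕℚ (m ℕ.+ n)          ≡⟨ cong (1ℚ +_) (fromℕℚ-+ m n) ⟩
    1ℚ + (fromℕℚ m + fromℕℚ n)     ≡⟨ ℚ.+-assoc 1ℚ (fromℕℚ m) (fromℕℚ n) ⟨
    1ℚ + fromℕℚ m + fromℕℚ n       ≡⟨ cong (_+ fromℕℚ n) (fromℕℚ-suc m) ⟨
    fromℕℚ (suc m) + fromℕℚ n      ∎
    where open ≡-Reasoning

  fromℕℚ-* : ∀ m n → fromℕℚ (m ℕ.* n) ≡ fromℕℚ m * fromℕℚ n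
  fromℕℚ-* zero    n = sym (ℚ.*-zeroˡ (fromℕℚ n))
  fromℕℚ-* (suc m) n = begin
    fromℕℚ (n ℕ.+ m ℕ.* n)                  ≡⟨ fromℕℚ-+ n (m ℕ.* n) ⟩
    fromℕℚ n + fromℕℚ (m ℕ.* n)             ≡⟨ cong (fromℕℚ n +_) (fromℕℚ-* m n) ⟩
    fromℕℚ n + fromℕℚ m * fromℕℚ n
      ≡⟨ solve 2 (λ m n → n :+ m :* n := (con 1ℚ :+ m) :* n) refl (fromℕℚ m) (fromℕℚ n) ⟩
    (1ℚ + fromℕℚ m) * fromℕℚ n              ≡⟨ cong (_* fromℕℚ n) (fromℕℚ-suc m) ⟨
    fromℕℚ (suc m) * fromℕℚ n               ∎
    where
    open ≡-Reasoning
    open +-*-Solver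

  0≤fromℕℚ : ∀ n → 0ℚ ≤ fromℕℚ n
  0≤fromℕℚ zero    = ℚ.≤-refl
  0≤fromℕℚ (suc n) = subst (0ℚ ≤_) (sym (fromℕℚ-suc n)) (add-nonNeg (ℚ.<⇒≤ (ℚ.positive⁻¹ 1ℚ)) (0≤fromℕℚ n))

  fromℕℚ-mono : ∀ {m n} → m ℕ.≤ n → fromℕℚ m ≤ fromℕℚ n
  fromℕℚ-mono {m} {n} m≤n = begin
    fromℕℚ m                              ≡⟨ ℚ.+-identityʳ (fromℕℚ m) ⟨
    fromℕℚ m + 0ℚ                         ≤⟨ ℚ.+-monoʳ-≤ (fromℕℚ m) (0≤fromℕℚ (n ℕ.∸ m)) ⟩
    fromℕℚ m + fromℕℚ (n ℕ.∸ m)           ≡⟨ fromℕℚ-+ m (n ℕ.∸ m) ⟨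
    fromℕℚ (m ℕ.+ (n ℕ.∸ m))              ≡⟨ cong fromℕℚ (ℕ.m+[n∸m]≡n m≤n) ⟩
    fromℕℚ n                              ∎
    where open ℚ.≤-Reasoning

  -- Powers, and an upper bound for the logarithm.

  pow : ℚ → ℕ → ℚ
  pow b zero    = 1ℚ
  pow b (suc l) = b * pow b l

  fromℕℚ-^ : ∀ b l → fromℕℚ (b ℕ.^ l) ≡ pow (fromℕℚ b) l
  fromℕℚ-^ b zero    = refl
  fromℕℚ-^ b (suc l) = trans (fromℕℚ-* b (b ℕ.^ l)) (cong (fromℕℚ b *_) (fromℕℚ-^ b l))

  pow-nonNeg : ∀ {b} → 0ℚ ≤ b → ∀ l → 0ℚ ≤ pow b l
  pow-nonNeg 0≤b zero    = ℚ.<⇒≤ (ℚ.positive⁻¹ 1ℚ)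
  pow-nonNeg 0≤b (suc l) = mul-nonNeg 0≤b (pow-nonNeg 0≤b l)

  pow-inverse : ∀ {b ι} → b * ι ≡ 1ℚ → ∀ l → pow b l * pow ι l ≡ 1ℚ
  pow-inverse         bι zero    = refl
  pow-inverse {b} {ι} bι (suc l) = begin
    b * pow b l * (ι * pow ι l)
      ≡⟨ solve 4 (λ b p i q → b :* p :* (i :* q) := (b :* i) :* (p :* q)) refl b (pow b l) ι (pow ι l) ⟩
    (b * ι) * (pow b l * pow ι l)   ≡⟨ cong₂ _*_ bι (pow-inverse {b} {ι} bι l) ⟩
    1ℚ                              ∎
    where
    open ≡-Reasoning
    open +-*-Solver

  -- The concave function Φ l x = Σ_{i=1}^{l} min(1, x / bⁱ) has slope at least
  -- 1 / bx on [1, bˡ], so b Φ l bounds the integral of 1/t by telescoping.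
  module LogBound {b ι : ℚ} (0≤b : 0ℚ ≤ b) (0≤ι : 0ℚ ≤ ι) (bι≡1 : b * ι ≡ 1ℚ)
    (f : ℚ → ℚ) (0≤f : ∀ t → 0ℚ ≤ f t) (f≤ : ∀ {t} i → pow b i ≤ t → f t ≤ pow ι i) where

    open ℚ.≤-Reasoning
    open +-*-Solver

    Φ : ℕ → ℚ → ℚ
    Φ zero    x = 0ℚ
    Φ (suc l) x = Φ l x + 1ℚ ⊓ (x * pow ι (suc l))

    term-mono : ∀ l {x y} → x ≤ y → 1ℚ ⊓ (x * pow ι l) ≤ 1ℚ ⊓ (y * pow ι l)
    term-mono l x≤y = ℚ.⊓-monoʳ-≤ 1ℚ (mulʳ-≤ (pow-nonNeg 0≤ι l) x≤y)

    Φ-mono : ∀ l {x y} → x ≤ y → Φ l x ≤ Φ l y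
    Φ-mono zero    x≤y = ℚ.≤-refl
    Φ-mono (suc l) x≤y = ℚ.+-mono-≤ (Φ-mono l x≤y) (term-mono (suc l) x≤y)

    Φ≤ : ∀ l x → Φ l x ≤ fromℕℚ l
    Φ≤ zero    x = ℚ.≤-refl
    Φ≤ (suc l) x = begin
      Φ l x + 1ℚ ⊓ (x * pow ι (suc l))  ≤⟨ ℚ.+-mono-≤ (Φ≤ l x) (ℚ.p⊓q≤p 1ℚ (x * pow ι (suc l))) ⟩
      fromℕℚ l + 1ℚ                     ≡⟨ ℚ.+-comm (fromℕℚ l) 1ℚ ⟩
      1ℚ + fromℕℚ l                     ≡⟨ fromℕℚ-suc l ⟨
      fromℕℚ (suc l)                    ∎

    0≤Φ : ∀ l {x} → 0ℚ ≤ x → 0ℚ ≤ Φ l x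
    0≤Φ zero    0≤x = ℚ.≤-refl
    0≤Φ (suc l) {x} 0≤x = add-nonNeg (0≤Φ l 0≤x)
      (ℚ.⊓-glb (ℚ.<⇒≤ (ℚ.positive⁻¹ 1ℚ)) (mul-nonNeg 0≤x (pow-nonNeg 0≤ι (suc l))))

    -- The estimate for one rectangle, whose height is sampled at the right endpoint `t`. If `t` is
    -- at least `pow b l`, the height is at most `pow ι l = b * pow ι (suc l)`, the slope of the
    -- last term of `b * Φ (suc l)`, which is still on its linear branch at `t`. Otherwise `l` drops
    -- by one and the last term is monotone. For `l = 0` the width is at most 0.
    piece : ∀ l {a t} → 1ℚ ≤ a → a ≤ t → t ≤ pow b l → (t - a) * f t + b * Φ l a ≤ b * Φ l t
    piece zero {a} {t} 1≤a a≤t t≤1 = begin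
      (t - a) * f t + b * 0ℚ
        ≤⟨ ℚ.+-monoˡ-≤ (b * 0ℚ) (mulʳ-≤ (0≤f t) (ℚ.+-monoˡ-≤ (- a) (ℚ.≤-trans t≤1 1≤a))) ⟩
      (a - a) * f t + b * 0ℚ
        ≡⟨ solve 3 (λ a f b → (a :- a) :* f :+ b :* con 0ℚ := b :* con 0ℚ) refl a (f t) b ⟩
      b * 0ℚ                    ∎
    piece (suc l) {a} {t} 1≤a a≤t t≤ with ℚ.≤-total t (pow b l)
    ... | inj₁ t≤l = begin
      (t - a) * f t + b * (Φ l a + m a)
        ≡⟨ solve 4 (λ x b p m → x :+ b :* (p :+ m) := (x :+ b :* p) :+ b :* m) refl ((t - a) * f t) b (Φ l a) (m a) ⟩
      ((t - a) * f t + b * Φ l a) + b * m a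
        ≤⟨ ℚ.+-mono-≤ (piece l 1≤a a≤t t≤l) (mulˡ-≤ 0≤b (term-mono (suc l) a≤t)) ⟩
      b * Φ l t + b * m t                      ≡⟨ ℚ.*-distribˡ-+ b (Φ l t) (m t) ⟨
      b * (Φ l t + m t)                        ∎
      where
      m : ℚ → ℚ
      m x = 1ℚ ⊓ (x * pow ι (suc l))
    ... | inj₂ l≤t = begin
      (t - a) * f t + b * (Φ l a + m a)
        ≤⟨ ℚ.+-mono-≤ (mulˡ-≤ 0≤t-a (f≤ l l≤t)) (mulˡ-≤ 0≤b (ℚ.+-mono-≤ (Φ-mono l a≤t) (ℚ.p⊓q≤q 1ℚ (a * q)))) ⟩
      (t - a) * pow ι l + b * (Φ l t + a * q)  ≡⟨ cong (λ z → (t - a) * z + b * (Φ l t + a * q)) ιl ⟩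
      (t - a) * (b * q) + b * (Φ l t + a * q)
        ≡⟨ solve 5 (λ t a b q p → (t :- a) :* (b :* q) :+ b :* (p :+ a :* q) := b :* (p :+ t :* q))
             refl t a b q (Φ l t) ⟩
      b * (Φ l t + t * q)                      ≡⟨ cong (λ z → b * (Φ l t + z)) (sym m≡) ⟩
      b * (Φ l t + m t)                        ∎
      where
      q = pow ι (suc l)
      m : ℚ → ℚ
      m x = 1ℚ ⊓ (x * q)
      0≤t-a : 0ℚ ≤ t - a
      0≤t-a = subst (_≤ t - a) (ℚ.+-inverseʳ a) (ℚ.+-monoˡ-≤ (- a) a≤t)
      ιl : pow ι l ≡ b * q
      ιl = trans (sym (ℚ.*-identityˡ (pow ι l))) (trans (cong (_* pow ι l) (sym bι≡1)) (ℚ.*-assoc b ι (pow ι l)))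
      m≡ : m t ≡ t * q
      m≡ = ℚ.p≥q⇒p⊓q≡q (ℚ.≤-trans (mulʳ-≤ (pow-nonNeg 0≤ι (suc l)) t≤)
             (ℚ.≤-reflexive (pow-inverse {b} {ι} bι≡1 (suc l))))

    mid-≥ : ∀ {a t} → a ≤ t → a ≤ ½ * (a + t)
    mid-≥ {a} {t} a≤t = subst (_≤ ½ * (a + t)) (solve 1 (λ a → con ½ :* (a :+ a) := a) refl a)
      (mulˡ-≤ 0≤½ (ℚ.+-monoʳ-≤ a a≤t))

    mid-≤ : ∀ {a t} → a ≤ t → ½ * (a + t) ≤ t
    mid-≤ {a} {t} a≤t = subst (½ * (a + t) ≤_) (solve 1 (λ a → con ½ :* (a :+ a) := a) refl t)
      (mulˡ-≤ 0≤½ (ℚ.+-monoˡ-≤ t a≤t))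

    telescope : ∀ k l {a t} → 1ℚ ≤ a → a ≤ t → t ≤ pow b l → riemann f k a t + b * Φ l a ≤ b * Φ l t
    telescope zero    l 1≤a a≤t t≤ = piece l 1≤a a≤t t≤
    telescope (suc k) l {a} {t} 1≤a a≤t t≤ = begin
      (x + y) + b * Φ l a
        ≡⟨ solve 3 (λ x y z → (x :+ y) :+ z := y :+ (x :+ z)) refl x y (b * Φ l a) ⟩
      y + (x + b * Φ l a)
        ≤⟨ ℚ.+-monoʳ-≤ y (telescope k l 1≤a (mid-≥ a≤t) (ℚ.≤-trans (mid-≤ a≤t) t≤)) ⟩
      y + b * Φ l m           ≤⟨ telescope k l (ℚ.≤-trans 1≤a (mid-≥ a≤t)) (mid-≤ a≤t) t≤ ⟩
      b * Φ l t               ∎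
      where
      m = ½ * (a + t)
      x = riemann f k a m
      y = riemann f k m t

    riemann≤ : ∀ k l {t} → 1ℚ ≤ t → t ≤ pow b l → riemann f k 1ℚ t ≤ b * fromℕℚ l
    riemann≤ k l {t} 1≤t t≤ = begin
      riemann f k 1ℚ t                  ≡⟨ ℚ.+-identityʳ _ ⟨
      riemann f k 1ℚ t + 0ℚ
        ≤⟨ ℚ.+-monoʳ-≤ (riemann f k 1ℚ t) (mul-nonNeg 0≤b (0≤Φ l (ℚ.<⇒≤ (ℚ.positive⁻¹ 1ℚ)))) ⟩
      riemann f k 1ℚ t + b * Φ l 1ℚ     ≤⟨ telescope k l ℚ.≤-refl 1≤t t≤ ⟩
      b * Φ l t                         ≤⟨ mulˡ-≤ 0≤b (Φ≤ l t) ⟩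
      b * fromℕℚ l                      ∎

  -- The bound holds term by term: term `n` of `log` is a Riemann sum up to term `n` of `x`, and
  -- clamping the argument from below can only lower the reciprocal.
  log≤ : ∀ {b ι} → 0ℚ ≤ b → 0ℚ ≤ ι → b * ι ≡ 1ℚ → ∀ x (0<x : 0ℝ <ℝ x) n l →
    1ℚ ≤ seq x n → seq x n ≤ pow b l → seq (log x 0<x) n ≤ b * fromℕℚ l
  log≤ {b} {ι} 0≤b 0≤ι bι≡1 x (δ , 0<δ , _) n l =
    LogBound.riemann≤ 0≤b 0≤ι bι≡1 recip (λ t → ℚ.<⇒≤ (recip-pos t)) recip≤ n l
    where
    open ClampedReciprocal (0<⊓1 0<δ)
    δ₁ = δ ⊓ 1ℚ
    recip≤ : ∀ {t} i → pow b i ≤ t → recip t ≤ pow ι i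
    recip≤ {t} i bⁱ≤t = begin
      recip t                            ≡⟨ ℚ.*-identityʳ (recip t) ⟨
      recip t * 1ℚ                       ≡⟨ cong (recip t *_) (sym (pow-inverse {b} {ι} bι≡1 i)) ⟩
      recip t * (pow b i * pow ι i)
        ≤⟨ mulˡ-≤ (ℚ.<⇒≤ (recip-pos t)) (mulʳ-≤ (pow-nonNeg 0≤ι i) (ℚ.≤-trans bⁱ≤t (ℚ.p≤q⊔p δ₁ t))) ⟩
      recip t * ((δ₁ ⊔ t) * pow ι i)
        ≡⟨ solve 3 (λ r d p → r :* (d :* p) := (d :* r) :* p) refl (recip t) (δ₁ ⊔ t) (pow ι i) ⟩
      ((δ₁ ⊔ t) * recip t) * pow ι i
        ≡⟨ cong (_* pow ι i) (ℚ.*-inverseʳ (δ₁ ⊔ t) ⦃ ℚ.>-nonZero (ℚ.<-≤-trans (0<⊓1 0<δ) (ℚ.p≤p⊔q δ₁ t)) ⦄) ⟩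
      1ℚ * pow ι i                       ≡⟨ ℚ.*-identityˡ (pow ι i) ⟩
      pow ι i                            ∎
      where
      open ℚ.≤-Reasoning
      open +-*-Solver

  -- Comparison and approximation of real numbers.

  near : ∀ {p q h} → abs (p - q) ≤ h → p ≤ q + h
  near {p} {q} {h} pq≤h = subst (_≤ q + h) (solve 2 (λ p q → q :+ (p :- q) := p) refl p q)
    (ℚ.+-monoʳ-≤ q (ℚ.≤-trans (p≤abs (p - q)) pq≤h))
    where open +-*-Solver

  -- For given `ε`, one decidable comparison of rational terms far out settles the matter: success
  -- gives the inequality up to `ε` from there on, and failure refutes `x ≤ℝ y`.
  ≤ℝ-stable : ∀ x y → ¬ ¬ (x ≤ℝ y) → x ≤ℝ y
  ≤ℝ-stable x y ¬¬x≤y ε 0<ε with cauchy x h 0<h | cauchy y h 0<h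
    where
    -- An eighth of `ε`. On success, the tested half of `ε` and two errors `h` stay below `ε`. On
    -- failure, a quarter of `ε` from `x ≤ℝ y` and two errors `h` make up exactly the tested half.
    h = ½ * (½ * (½ * ε))
    0<h = half-pos (half-pos (half-pos 0<ε))
  ... | Nx , x-near | Ny , y-near with seq x (Nx ℕ.⊔ Ny) ℚ.≤? seq y (Nx ℕ.⊔ Ny) + ½ * ε
  ... | yes x≤y = N , λ n N≤n → begin
    seq x n
      ≤⟨ near {seq x n} {seq x N} (x-near n N (ℕ.≤-trans (ℕ.m≤m⊔n Nx Ny) N≤n) (ℕ.m≤m⊔n Nx Ny)) ⟩
    seq x N + h                     ≤⟨ ℚ.+-monoˡ-≤ h x≤y ⟩
    seq y N + ½ * ε + h
      ≤⟨ ℚ.+-monoˡ-≤ h (ℚ.+-monoˡ-≤ (½ * ε) (near {seq y N} {seq y n}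
           (y-near N n (ℕ.m≤n⊔m Nx Ny) (ℕ.≤-trans (ℕ.m≤n⊔m Nx Ny) N≤n)))) ⟩
    seq y n + h + ½ * ε + h
      ≡⟨ solve 2 (λ y e → y :+ con ½ :* (con ½ :* (con ½ :* e)) :+ con ½ :* e :+ con ½ :* (con ½ :* (con ½ :* e))
                                        := (y :+ e) :+ (:- (con ½ :* (con ½ :* e)))) refl (seq y n) ε ⟩
    (seq y n + ε) + - (½ * (½ * ε))
      ≤⟨ ℚ.+-monoʳ-≤ (seq y n + ε) (ℚ.neg-antimono-≤ (ℚ.<⇒≤ (half-pos (half-pos 0<ε)))) ⟩
    (seq y n + ε) + 0ℚ              ≡⟨ ℚ.+-identityʳ _ ⟩
    seq y n + ε                     ∎
    where
    N = Nx ℕ.⊔ Ny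
    h = ½ * (½ * (½ * ε))
    open ℚ.≤-Reasoning
    open +-*-Solver
  ... | no x≰y = contradiction x≰ ¬¬x≤y
    where
    N = Nx ℕ.⊔ Ny
    h = ½ * (½ * (½ * ε))
    e = ½ * (½ * ε)
    open ℚ.≤-Reasoning
    open +-*-Solver
    x≰ : ¬ (x ≤ℝ y)
    x≰ x≤y with M , x≤ ← x≤y e (half-pos (half-pos 0<ε)) = x≰y (begin
      seq x N
        ≤⟨ near {seq x N} {seq x n} (x-near N n (ℕ.m≤m⊔n Nx Ny) (ℕ.≤-trans (ℕ.m≤m⊔n Nx Ny) (ℕ.m≤m⊔n N M))) ⟩
      seq x n + h             ≤⟨ ℚ.+-monoˡ-≤ h (x≤ n (ℕ.m≤n⊔m N M)) ⟩
      seq y n + e + h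
        ≤⟨ ℚ.+-monoˡ-≤ h (ℚ.+-monoˡ-≤ e (near {seq y n} {seq y N}
             (y-near n N (ℕ.≤-trans (ℕ.m≤n⊔m Nx Ny) (ℕ.m≤m⊔n N M)) (ℕ.m≤n⊔m Nx Ny)))) ⟩
      seq y N + h + e + h
        ≡⟨ solve 2 (λ y e → y :+ con ½ :* (con ½ :* (con ½ :* e)) :+ con ½ :* (con ½ :* e)
                          :+ con ½ :* (con ½ :* (con ½ :* e))
                                        := y :+ con ½ :* e) refl (seq y N) ε ⟩
      seq y N + ½ * ε         ∎)
      where
      n = N ℕ.⊔ M

  floor : ∀ q n → 0ℚ ≤ q → q < fromℕℚ n → ∃[ k ] fromℕℚ k ≤ q × q < fromℕℚ (suc k)
  floor q zero    0≤q q<0 = contradiction (ℚ.≤-<-trans 0≤q q<0) (ℚ.<-irrefl refl)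
  floor q (suc n) 0≤q q<n with fromℕℚ n ℚ.≤? q
  ... | yes n≤q = n , n≤q , q<n
  ... | no n≰q  = floor q n 0≤q (ℚ.≰⇒> n≰q)

  fromℕℚ-cancel-< : ∀ {m n} → fromℕℚ m < fromℕℚ n → m ℕ.< n
  fromℕℚ-cancel-< {m} {n} m<n = ℕ.≰⇒> λ n≤m → ℚ.<-irrefl refl (ℚ.<-≤-trans m<n (fromℕℚ-mono n≤m))

  fromℕℚ-+1 : ∀ n → fromℕℚ n + 1ℚ ≡ fromℕℚ (suc n)
  fromℕℚ-+1 n = trans (ℚ.+-comm (fromℕℚ n) 1ℚ) (sym (fromℕℚ-suc n))

  +1-< : ∀ {q} n → q < fromℕℚ n → q + 1ℚ < fromℕℚ (suc n)
  +1-< {q} n q<n = subst (q + 1ℚ <_) (fromℕℚ-+1 n) (ℚ.+-monoˡ-< 1ℚ q<n)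

  -1-≤ : ∀ {q} n → fromℕℚ (suc n) ≤ q → fromℕℚ n ≤ q - 1ℚ
  -1-≤ {q} n n<q = subst (_≤ q - 1ℚ)
    (trans (cong (_- 1ℚ) (fromℕℚ-suc n)) (solve 1 (λ n → (con 1ℚ :+ n) :- con 1ℚ := n) refl (fromℕℚ n)))
    (ℚ.+-monoˡ-≤ (- 1ℚ) n<q)
    where open +-*-Solver

  ⌊_⌋ : ∀ q → 0ℚ ≤ q → ∃[ k ] fromℕℚ k ≤ q × q < fromℕℚ (suc k)
  ⌊ q ⌋ 0≤q with n , q≤n ← archimedean q = floor q (suc n) 0≤q (ℚ.≤-<-trans q≤n
    (subst₂ _<_ (ℚ.+-identityˡ (fromℕℚ n)) (sym (fromℕℚ-suc n)) (ℚ.+-monoˡ-< (fromℕℚ n) (ℚ.positive⁻¹ 1ℚ))))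

  -- Brackets `c` without deciding any real inequality: later terms differ from one term `q` by at
  -- most 1, and `k` is the floor of `q - 1`, so they lie between `k` and `k + 3`. The 3 in the
  -- hypothesis pays for the slack in `≤ℝ`, the distance to `q`, and the 1 subtracted from `q`.
  approximate : ∀ c j → fromℕ (3 ℕ.+ j) ≤ℝ c → ∃[ k ] j ℕ.≤ k ×
    ∃[ N ] ∀ n → N ℕ.≤ n → fromℕℚ k ≤ seq c n × seq c n ≤ fromℕℚ (3 ℕ.+ k)
  approximate c j j≤c with cauchy c 1ℚ (ℚ.positive⁻¹ 1ℚ) | j≤c 1ℚ (ℚ.positive⁻¹ 1ℚ)
  ... | N₁ , c-near | N₂ , j≤ = bracket (⌊ q - 1ℚ ⌋ (ℚ.≤-trans (0≤fromℕℚ j) j≤q-1))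
    where
    open +-*-Solver
    q = seq c N₁
    N = N₁ ℕ.⊔ N₂
    j≤q-1 : fromℕℚ j ≤ q - 1ℚ
    j≤q-1 = ℚ.≤-trans (-1-≤ j (-1-≤ (1 ℕ.+ j) (-1-≤ (2 ℕ.+ j) (ℚ.≤-trans (j≤ N (ℕ.m≤n⊔m N₁ N₂))
        (ℚ.+-monoˡ-≤ 1ℚ (near {seq c N} {q} (c-near N N₁ (ℕ.m≤m⊔n N₁ N₂) ℕ.≤-refl)))))))
      (ℚ.≤-reflexive (solve 1 (λ q → (q :+ con 1ℚ :+ con 1ℚ) :- con 1ℚ :- con 1ℚ :- con 1ℚ := q :- con 1ℚ) refl q))
    bracket : ∃[ k ] fromℕℚ k ≤ q - 1ℚ × q - 1ℚ < fromℕℚ (suc k) →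
      ∃[ k ] j ℕ.≤ k × ∃[ N ] ∀ n → N ℕ.≤ n → fromℕℚ k ≤ seq c n × seq c n ≤ fromℕℚ (3 ℕ.+ k)
    bracket (k , k≤ , <k+1) = k , ℕ.s≤s⁻¹ (fromℕℚ-cancel-< {j} {suc k} (ℚ.≤-<-trans j≤q-1 <k+1)) , N₁ , λ n N₁≤n →
      ℚ.≤-trans k≤ (subst (q - 1ℚ ≤_) (solve 1 (λ c → (c :+ con 1ℚ) :- con 1ℚ := c) refl (seq c n))
        (ℚ.+-monoˡ-≤ (- 1ℚ) (near {q} {seq c n} (c-near N₁ n ℕ.≤-refl N₁≤n)))) ,
      ℚ.≤-trans (near {seq c n} {q} (c-near n N₁ N₁≤n ℕ.≤-refl)) (ℚ.<⇒≤
        (subst (_< fromℕℚ (3 ℕ.+ k)) (solve 1 (λ q → ((q :- con 1ℚ) :+ con 1ℚ) :+ con 1ℚ := q :+ con 1ℚ) refl q)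
          (+1-< (2 ℕ.+ k) (+1-< (1 ℕ.+ k) <k+1))))

  -- Integer logarithms, choice of the parameters, and the growth bound.

  module _ {B : ℕ} (2≤B : 2 ℕ.≤ B) where

    1≤^ : ∀ l → 1 ℕ.≤ B ℕ.^ l
    1≤^ l = ℕ.m^n>0 B {{ℕ.>-nonZero (ℕ.≤-trans (s≤s z≤n) 2≤B)}} l

    double-^ : ∀ l → 2 ℕ.* B ℕ.^ l ℕ.≤ B ℕ.^ suc l
    double-^ l = ℕ.*-monoˡ-≤ (B ℕ.^ l) 2≤B

    <^ : ∀ k → k ℕ.< B ℕ.^ k
    <^ zero    = s≤s z≤n
    <^ (suc k) = begin-strict
      suc k                          <⟨ ℕ.+-mono-≤-< (1≤^ k) (<^ k) ⟩
      B ℕ.^ k ℕ.+ B ℕ.^ k            ≡⟨ cong (B ℕ.^ k ℕ.+_) (ℕ.+-identityʳ (B ℕ.^ k)) ⟨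
      2 ℕ.* B ℕ.^ k                  ≤⟨ double-^ k ⟩
      B ℕ.^ suc k                    ∎
      where open ℕ.≤-Reasoning

    logarithm : ∀ k → 1 ℕ.≤ k → ∃[ L ] B ℕ.^ L ℕ.≤ k × k ℕ.< B ℕ.^ suc L
    logarithm k 1≤k = search k (<^ k)
      where
      search : ∀ l → k ℕ.< B ℕ.^ l → ∃[ L ] B ℕ.^ L ℕ.≤ k × k ℕ.< B ℕ.^ suc L
      search zero    k<1 = contradiction 1≤k (ℕ.<⇒≱ k<1)
      search (suc l) k<  with B ℕ.^ l ℕ.≤? k
      ... | yes ≤k = l , ≤k , k<
      ... | no ≰k  = search l (ℕ.≰⇒> ≰k)

  -- If k ≤ c ≤ k + 3, then an expander on 10s ≤ kL vertices whose balls of radius r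
  -- have at most B ^ r vertices has growth at most cr, while s is of order c log c.
  record Parameters (B k s L : ℕ) : Set where
    field
      0<B    : 0 ℕ.< B
      0<s    : 0 ℕ.< s
      10s≤kL : 10 ℕ.* s ℕ.≤ k ℕ.* L
      B^L≤k  : B ℕ.^ L ℕ.≤ k
      3+k≤B^ : 3 ℕ.+ k ℕ.≤ B ℕ.^ (2 ℕ.+ L)
      clogc≤ : (3 ℕ.+ k) ℕ.* (B ℕ.* (2 ℕ.+ L)) ℕ.≤ 40 ℕ.* B ℕ.* (2 ℕ.* s)

  -- `L` is the integer logarithm of `k` to base `B`, and `s` is `k * L / 10` rounded down. In the
  -- lower bound on `k`, the summand `B * B` forces `2 ≤ L`, and 10 forces `0 < s`.
  parameters : ∀ {B k} → 2 ℕ.≤ B → 10 ℕ.+ B ℕ.* B ℕ.≤ k → ∃[ s ] ∃[ L ] Parameters B k s L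
  parameters {B} {k} 2≤B large = choose (logarithm 2≤B k (ℕ.≤-trans (s≤s z≤n) 10≤k))
    where
    10≤k : 10 ℕ.≤ k
    10≤k = ℕ.≤-trans (ℕ.m≤m+n 10 (B ℕ.* B)) large

    choose : ∃[ L ] B ℕ.^ L ℕ.≤ k × k ℕ.< B ℕ.^ suc L → ∃[ s ] ∃[ L ] Parameters B k s L
    choose (L , B^L≤k , k<B^) = s , L , record
      { 0<B    = ℕ.≤-trans (s≤s z≤n) 2≤B
      ; 0<s    = 0<s
      ; 10s≤kL = subst (ℕ._≤ k ℕ.* L) (ℕ.*-comm s 10) (m/n*n≤m (k ℕ.* L) 10)
      ; B^L≤k  = B^L≤k
      ; 3+k≤B^ = 3+k≤B^
      ; clogc≤ = clogc≤
      }
      where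
      open ℕ.≤-Reasoning
      open ℕ-Solver

      s : ℕ
      s = k ℕ.* L ℕ./ 10

      2≤L : 2 ℕ.≤ L
      2≤L = ℕ.≮⇒≥ λ L<2 → ℕ.<-irrefl refl (begin-strict
        k                <⟨ k<B^ ⟩
        B ℕ.^ suc L      ≤⟨ ℕ.^-monoʳ-≤ B {{ℕ.>-nonZero (ℕ.≤-trans (s≤s z≤n) 2≤B)}} L<2 ⟩
        B ℕ.^ 2          ≡⟨ cong (B ℕ.*_) (ℕ.*-identityʳ B) ⟩
        B ℕ.* B          ≤⟨ ℕ.m≤n+m (B ℕ.* B) 10 ⟩
        10 ℕ.+ B ℕ.* B   ≤⟨ large ⟩
        k                ∎)

      0<s : 0 ℕ.< s
      0<s = m≥n⇒m/n>0 {k ℕ.* L} {10} (ℕ.≤-trans 10≤k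
        (subst (ℕ._≤ k ℕ.* L) (ℕ.*-identityʳ k) (ℕ.*-monoʳ-≤ k (ℕ.≤-trans (s≤s z≤n) 2≤L))))

      3+k≤B^ : 3 ℕ.+ k ℕ.≤ B ℕ.^ (2 ℕ.+ L)
      3+k≤B^ = begin
        2 ℕ.+ suc k
          ≤⟨ ℕ.+-mono-≤ (ℕ.≤-trans (ℕ.*-monoʳ-≤ 2 (1≤^ 2≤B L)) (double-^ 2≤B L)) k<B^ ⟩
        B ℕ.^ suc L ℕ.+ B ℕ.^ suc L     ≡⟨ cong (B ℕ.^ suc L ℕ.+_) (ℕ.+-identityʳ (B ℕ.^ suc L)) ⟨
        2 ℕ.* B ℕ.^ suc L               ≤⟨ double-^ 2≤B (suc L) ⟩
        B ℕ.^ (2 ℕ.+ L)                 ∎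

      kL≤20s : k ℕ.* L ℕ.≤ 20 ℕ.* s
      kL≤20s = begin
        k ℕ.* L                         ≡⟨ m≡m%n+[m/n]*n (k ℕ.* L) 10 ⟩
        k ℕ.* L ℕ.% 10 ℕ.+ s ℕ.* 10     ≤⟨ ℕ.+-monoˡ-≤ (s ℕ.* 10) (ℕ.<⇒≤ (m%n<n (k ℕ.* L) 10)) ⟩
        10 ℕ.+ s ℕ.* 10                 ≤⟨ ℕ.+-monoˡ-≤ (s ℕ.* 10) (ℕ.*-monoˡ-≤ 10 0<s) ⟩
        s ℕ.* 10 ℕ.+ s ℕ.* 10
          ≡⟨ solve 1 (λ s → s :* con 10 :+ s :* con 10 := con 20 :* s) refl s ⟩
        20 ℕ.* s                        ∎

      -- Three doublings absorb the lower-order terms: `3 + k ≤ 2 k`, `2 + L ≤ 2 L`, and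
      -- `k L ≤ 20 s` for the rounding in `s`. This gives `4 * 20 = 40 * 2`.
      clogc≤ : (3 ℕ.+ k) ℕ.* (B ℕ.* (2 ℕ.+ L)) ℕ.≤ 40 ℕ.* B ℕ.* (2 ℕ.* s)
      clogc≤ = begin
        (3 ℕ.+ k) ℕ.* (B ℕ.* (2 ℕ.+ L))
          ≤⟨ ℕ.*-mono-≤ (ℕ.+-monoˡ-≤ k (ℕ.≤-trans (s≤s (s≤s (s≤s z≤n))) 10≤k)) (ℕ.*-monoʳ-≤ B (ℕ.+-monoˡ-≤ L 2≤L)) ⟩
        (k ℕ.+ k) ℕ.* (B ℕ.* (L ℕ.+ L))
          ≡⟨ solve 3 (λ k B L → (k :+ k) :* (B :* (L :+ L)) := con 4 :* B :* (k :* L)) refl k B L ⟩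
        4 ℕ.* B ℕ.* (k ℕ.* L)           ≤⟨ ℕ.*-monoʳ-≤ (4 ℕ.* B) kL≤20s ⟩
        4 ℕ.* B ℕ.* (20 ℕ.* s)
          ≡⟨ solve 2 (λ B s → con 4 :* B :* (con 20 :* s) := con 40 :* B :* (con 2 :* s)) refl B s ⟩
        40 ℕ.* B ℕ.* (2 ℕ.* s)          ∎

  growth≤ : ∀ {B k s L} → Parameters B k s L → ∀ G → Graph.order G ≡ 10 ℕ.* s →
    (∀ u → # (Graph.adj G u) ℕ.< B) → ∀ {r} → 1 ℕ.≤ r →
    (H : Subgraph G) → RadiusAtMost H r → ∣ Subgraph.vertices H ∣ ℕ.≤ k ℕ.* r
  growth≤ {B} {k} {s} {L} params G order≡ deg< {r} 1≤r H radius with L ℕ.≤? r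
  ... | yes L≤r = begin
    ∣ Subgraph.vertices H ∣     ≤⟨ growth≤order G H ⟩
    Graph.order G               ≡⟨ order≡ ⟩
    10 ℕ.* s                    ≤⟨ 10s≤kL ⟩
    k ℕ.* L                     ≤⟨ ℕ.*-monoʳ-≤ k L≤r ⟩
    k ℕ.* r                     ∎
    where
    open ℕ.≤-Reasoning
    open Parameters params
  ... | no L≰r = begin
    ∣ Subgraph.vertices H ∣     ≤⟨ growth≤^ G deg< H radius ⟩
    B ℕ.^ r                     ≤⟨ ℕ.^-monoʳ-≤ B {{ℕ.>-nonZero 0<B}} (ℕ.<⇒≤ (ℕ.≰⇒> L≰r)) ⟩
    B ℕ.^ L                     ≤⟨ B^L≤k ⟩
    k                           ≡⟨ ℕ.*-identityʳ k ⟨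
    k ℕ.* 1                     ≤⟨ ℕ.*-monoʳ-≤ k 1≤r ⟩
    k ℕ.* r                     ∎
    where
    open ℕ.≤-Reasoning
    open Parameters params

  -- The lower bound for `g`.

  fromℕ≤ : ∀ {m} x N → (∀ n → N ℕ.≤ n → fromℕℚ m ≤ seq x n) → fromℕ m ≤ℝ x
  fromℕ≤ x N m≤ ε 0<ε = N , λ n N≤n → ℚ.≤-trans (m≤ n N≤n)
    (subst (_≤ seq x n + ε) (ℚ.+-identityʳ (seq x n)) (ℚ.+-monoʳ-≤ (seq x n) (ℚ.<⇒≤ 0<ε)))

  fromℕℚ-pos : ∀ n → 0ℚ < fromℕℚ (suc n)
  fromℕℚ-pos n = subst (0ℚ <_) (sym (fromℕℚ-suc n)) (ℚ.<-≤-trans (ℚ.positive⁻¹ 1ℚ)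
    (subst (_≤ 1ℚ + fromℕℚ n) (ℚ.+-identityʳ 1ℚ) (ℚ.+-monoʳ-≤ 1ℚ (0≤fromℕℚ n))))

  scaled-clogc≤ : ∀ {B k s L ε ι} → Parameters B k s L → 1 ℕ.≤ k →
    0ℚ ≤ ε → ε * fromℕℚ (40 ℕ.* B) ≡ 1ℚ → 0ℚ ≤ ι → fromℕℚ B * ι ≡ 1ℚ →
    ∀ c (0<c : 0ℝ <ℝ c) n → fromℕℚ k ≤ seq c n → seq c n ≤ fromℕℚ (3 ℕ.+ k) →
    ε * (seq c n * seq (log c 0<c) n) ≤ fromℕℚ (2 ℕ.* s)
  scaled-clogc≤ {B} {k} {s} {L} {ε} params 1≤k 0≤ε εM≡1 0≤ι Bι≡1 c 0<c n k≤c c≤k+3 = begin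
    ε * (seq c n * seq (log c 0<c) n)
      ≤⟨ mulˡ-≤ 0≤ε (mulˡ-≤ (ℚ.≤-trans (0≤fromℕℚ k) k≤c) log-c≤) ⟩
    ε * (seq c n * (fromℕℚ B * fromℕℚ (2 ℕ.+ L)))
      ≤⟨ mulˡ-≤ 0≤ε (mulʳ-≤ (mul-nonNeg (0≤fromℕℚ B) (0≤fromℕℚ (2 ℕ.+ L))) c≤k+3) ⟩
    ε * (fromℕℚ (3 ℕ.+ k) * (fromℕℚ B * fromℕℚ (2 ℕ.+ L)))
      ≡⟨ cong (λ z → ε * (fromℕℚ (3 ℕ.+ k) * z)) (fromℕℚ-* B (2 ℕ.+ L)) ⟨
    ε * (fromℕℚ (3 ℕ.+ k) * fromℕℚ (B ℕ.* (2 ℕ.+ L)))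
      ≡⟨ cong (ε *_) (fromℕℚ-* (3 ℕ.+ k) (B ℕ.* (2 ℕ.+ L))) ⟨
    ε * fromℕℚ ((3 ℕ.+ k) ℕ.* (B ℕ.* (2 ℕ.+ L)))         ≤⟨ mulˡ-≤ 0≤ε (fromℕℚ-mono clogc≤) ⟩
    ε * fromℕℚ (40 ℕ.* B ℕ.* (2 ℕ.* s))
      ≡⟨ cong (ε *_) (fromℕℚ-* (40 ℕ.* B) (2 ℕ.* s)) ⟩
    ε * (fromℕℚ (40 ℕ.* B) * fromℕℚ (2 ℕ.* s))
      ≡⟨ ℚ.*-assoc ε (fromℕℚ (40 ℕ.* B)) (fromℕℚ (2 ℕ.* s)) ⟨
    ε * fromℕℚ (40 ℕ.* B) * fromℕℚ (2 ℕ.* s)             ≡⟨ cong (_* fromℕℚ (2 ℕ.* s)) εM≡1 ⟩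
    1ℚ * fromℕℚ (2 ℕ.* s)                                ≡⟨ ℚ.*-identityˡ (fromℕℚ (2 ℕ.* s)) ⟩
    fromℕℚ (2 ℕ.* s)                                     ∎
    where
    open Parameters params
    open ℚ.≤-Reasoning
    log-c≤ : seq (log c 0<c) n ≤ fromℕℚ B * fromℕℚ (2 ℕ.+ L)
    log-c≤ = log≤ (0≤fromℕℚ B) 0≤ι Bι≡1 c 0<c n (2 ℕ.+ L)
      (ℚ.≤-trans (fromℕℚ-mono {1} {k} 1≤k) k≤c)
      (ℚ.≤-trans c≤k+3 (ℚ.≤-trans (fromℕℚ-mono 3+k≤B^) (ℚ.≤-reflexive (fromℕℚ-^ B (2 ℕ.+ L)))))

  reciprocal : ∀ n .{{_ : ℕ.NonZero n}} → ∃[ ι ] 0ℚ < ι × fromℕℚ n * ι ≡ 1ℚ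
  reciprocal (suc n) = 1/ q , ClampedReciprocal.1/-pos 0<½ (fromℕℚ-pos n) , ℚ.*-inverseʳ q
    where
    q = fromℕℚ (suc n)
    instance
      q≢0 : ℚ.NonZero q
      q≢0 = ℚ.>-nonZero (fromℕℚ-pos n)

  TreewidthBound : (ℝ → ℝ) → Set
  TreewidthBound g = ∀ c → 1ℝ ≤ℝ c → ∀ G →
    (∀ r → 1 ℕ.≤ r → ∀ m → IsGrowth G r m → fromℕ m ≤ℝ c *ℝ fromℕ r) →
    ∀ t → IsTreewidth G t → fromℤ t ≤ℝ g c

  module LowerBound (g : ℝ → ℝ) (bounds : TreewidthBound g) where

    -- The treewidth of G exists only up to double negation, which ≤ℝ absorbs.
    expander≤g : ∀ {B k s L} → Parameters B k s L → 1 ℕ.≤ k →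
      ∀ G → Graph.order G ≡ 10 ℕ.* s → (∀ u → # (Graph.adj G u) ℕ.< B) → Expanding G (2 ℕ.* s) →
      ∀ c N → (∀ n → N ℕ.≤ n → fromℕℚ k ≤ seq c n) → fromℕ (2 ℕ.* s) ≤ℝ g c
    expander≤g {_} {k} {s} params 1≤k G order≡ deg< expanding c N k≤c =
      ≤ℝ-stable (fromℕ (2 ℕ.* s)) (g c) λ ¬≤ → ¬¬-treewidth G λ (t , tw) →
        ¬≤ (below t tw (treewidth-expanding expanding 5w≤n 0<2s tw))
      where
      open Parameters params
      5w≤n : 5 ℕ.* (2 ℕ.* s) ℕ.≤ Graph.order G
      5w≤n = ℕ.≤-reflexive (trans (sym (ℕ.*-assoc 5 2 s)) (sym order≡))
      0<2s : 0 ℕ.< 2 ℕ.* s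
      0<2s = ℕ.*-monoʳ-< 2 0<s
      linear : ∀ r → 1 ℕ.≤ r → ∀ m → IsGrowth G r m → fromℕ m ≤ℝ c *ℝ fromℕ r
      linear r 1≤r m ((H , radius , refl) , _) = fromℕ≤ {∣ Subgraph.vertices H ∣} (c *ℝ fromℕ r) N λ n N≤n →
        ℚ.≤-trans (fromℕℚ-mono {∣ Subgraph.vertices H ∣} {k ℕ.* r} (growth≤ params G order≡ deg< 1≤r H radius))
        (subst (_≤ seq c n * fromℕℚ r) (sym (fromℕℚ-* k r)) (mulʳ-≤ (0≤fromℕℚ r) (k≤c n N≤n)))
      1≤c : 1ℝ ≤ℝ c
      1≤c = fromℕ≤ {1} c N (λ n N≤n → ℚ.≤-trans (fromℕℚ-mono {1} {k} 1≤k) (k≤c n N≤n))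
      below : ∀ t → IsTreewidth G t → ∃[ n ] t ≡ ℤ.+ n × 2 ℕ.* s ℕ.≤ n → fromℕ (2 ℕ.* s) ≤ℝ g c
      below _ tw (n , refl , 2s≤n) ε 0<ε =
        let M , n≤ = bounds c 1≤c G linear (ℤ.+ n) tw ε 0<ε
        in  M , λ i M≤i → ℚ.≤-trans (fromℕℚ-mono {2 ℕ.* s} {n} 2s≤n) (n≤ i M≤i)

    module _ {B j : ℕ} (2≤B : 2 ℕ.≤ B) (j≡ : j ≡ 10 ℕ.+ B ℕ.* B) (graphs : BoundedDegreeExpanders B) {ε ι : ℚ}
      (0<ε : 0ℚ < ε) (Mε≡1 : fromℕℚ (40 ℕ.* B) * ε ≡ 1ℚ) (0<ι : 0ℚ < ι) (Bι≡1 : fromℕℚ B * ι ≡ 1ℚ) where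

      bound : ∀ c (0<c : 0ℝ <ℝ c) →
        (∃[ k ] j ℕ.≤ k × ∃[ N ] ∀ n → N ℕ.≤ n → fromℕℚ k ≤ seq c n × seq c n ≤ fromℕℚ (3 ℕ.+ k)) →
        fromℚ ε *ℝ (c *ℝ log c 0<c) ≤ℝ g c
      bound c 0<c (k , j≤k , N , near-c) η 0<η = combine (parameters {B} {k} 2≤B (subst (ℕ._≤ k) j≡ j≤k))
        where
        1≤k : 1 ℕ.≤ k
        1≤k = ℕ.≤-trans (s≤s z≤n) (subst (ℕ._≤ k) j≡ j≤k)
        combine : ∃[ s ] ∃[ L ] Parameters B k s L →
          ∃[ N ] ∀ n → N ℕ.≤ n → ε * (seq c n * seq (log c 0<c) n) ≤ seq (g c) n + η
        combine (s , L , params) =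
          let G , order≡ , deg< , expanding = graphs s {{ℕ.>-nonZero (Parameters.0<s params)}}
              N′ , 2s≤g = expander≤g params 1≤k G order≡ deg< expanding c N (λ n N≤n → proj₁ (near-c n N≤n)) η 0<η
          in N ℕ.⊔ N′ , λ n N≤n → let n₁ , n₂ = ⊔-split N N′ N≤n in
              ℚ.≤-trans (scaled-clogc≤ params 1≤k (ℚ.<⇒≤ 0<ε) (trans (ℚ.*-comm ε (fromℕℚ (40 ℕ.* B))) Mε≡1)
                          (ℚ.<⇒≤ 0<ι) Bι≡1 c 0<c n (proj₁ (near-c n n₁)) (proj₂ (near-c n n₁)))
                        (2s≤g n n₂)

      ∈Ω-clogc : g ∈Ω (λ c 0<c → c *ℝ log c 0<c)
      ∈Ω-clogc = fromℚ ε , (ε , 0<ε , 0 , λ _ _ → ℚ.≤-reflexive (ℚ.+-identityˡ ε)) ,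
        -- The threshold is what `parameters` requires of `k`, plus the 3 lost in `approximate`.
        fromℕ (3 ℕ.+ j) , λ c 0<c j≤c → bound c 0<c (approximate c j j≤c)

  ∈Ω-clogc-from : ∃[ B ] 2 ℕ.≤ B × BoundedDegreeExpanders B → ∀ g → TreewidthBound g →
    g ∈Ω (λ c 0<c → c *ℝ log c 0<c)
  ∈Ω-clogc-from (B@(suc _) , 2≤B , graphs) g bounds =
    -- The constant of the lower bound is `1 / (40 * B)`, matching `clogc≤`.
    let ε , 0<ε , Mε≡1 = reciprocal (40 ℕ.* B)
        ι , 0<ι , Bι≡1 = reciprocal B
    in LowerBound.∈Ω-clogc g bounds 2≤B refl graphs 0<ε Mε≡1 0<ι Bι≡1

open import Defs
open import Data.Nat.Base using (ℕ; _≤_)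
open import Data.Integer.Base using (ℤ)
open import Function.Definitions using (Congruent)

theorem8 :
    (g : ℝ → ℝ) →
    Congruent _≃_ _≃_ g →
    ((c : ℝ) → 1ℝ ≤ℝ c →
     (G : Graph) →
     ((r : ℕ) → 1 ≤ r → (m : ℕ) → IsGrowth G r m → fromℕ m ≤ℝ c *ℝ fromℕ r) →
     (t : ℤ) → IsTreewidth G t → fromℤ t ≤ℝ g c) →
    g ∈Ω (λ c 0<c → c *ℝ log c 0<c)
theorem8 g _ bounds = Analysis.∈Ω-clogc-from Combinatorics.bounded-degree-expanders g bounds
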